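{- There exists a number $n_0$ such that the following holds. Suppose $G$ is a fascinating graph with $n\ge n_0$ vertices and $m$ edges, where $m>\frac{1}{4}(n^2+2n+17)$. Then $G$ is a graph join of two cycles.
   Context: For a graph $G$ and a vertex $v$, $N_v=\{w: vw\in E(G)\}$. For a clique $\sigma$ in $G$, the link $\mathrm{lk}_G\sigma$ is the subgraph of $G$ induced by $\bigcap_{v\in\sigma}N_v$ (the vertices not in $\sigma$ adjacent to every vertex of $\sigma$). The length of a cycle is its number of vertices. A graph $G$ with $n$ vertices and $m$ edges is fascinating if: (a) $G$ contains exactly $2(m-n)$ triangles; (b) for every edge $e$ of $G$, $\mathrm{lk}_G e$ is a cycle of length at least $4$; (c) for every triangle $t$ of $G$, $\mathrm{lk}_G t$ is the graph with exactly $2$ vertices and no edges; (d) for every vertex $v$ of $G$, $\mathrm{lk}_G v$ is a connected planar graph whose every face (including the unbounded one) is a triangle, and $\mathrm{lk}_G v$ has at least $6$ vertices. The graph join $G\ast H$ of two graphs is their disjoint union together with all edges between $V(G)$ and $V(H)$. -}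

module Defs where

open import Data.Nat using (ℕ; zero; suc; _+_; _*_; _≤_; _<_; _<ᵇ_; _≡ᵇ_; _∸_)
open import Data.Bool using (Bool; true; false; _∧_; _∨_; not; if_then_else_)
open import Data.Fin using (Fin; toℕ)
import Data.Fin as F
open import Data.Product using (Σ; ∃; ∃-syntax; _×_; _,_)
open import Data.Sum using (_⊎_)
open import Function using (_∘_)
open import Function.Bundles using (_⇔_)
open import Relation.Binary.PropositionalEquality using (_≡_)

record Graph (n : ℕ) : Set where
  field
    adj    : Fin n → Fin n → Bool
    sym    : ∀ i j → adj i j ≡ adj j i
    irrefl : ∀ i → adj i i ≡ false
open Graph public

-- A vertex subset (vertex set of an induced subgraph, e.g. a link).
Sub : ℕ → Set
Sub n = Fin n → Bool

sumF : ∀ {n} → (Fin n → ℕ) → ℕ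
sumF {zero}  f = 0
sumF {suc n} f = f F.zero + sumF (f ∘ F.suc)

count : ∀ {n} → (Fin n → Bool) → ℕ
count p = sumF λ i → if p i then 1 else 0

_<F_ : ∀ {n} → Fin n → Fin n → Bool
i <F j = toℕ i <ᵇ toℕ j

module _ {n : ℕ} (G : Graph n) where

  all : Sub n
  all _ = true

  vcount : Sub n → ℕ
  vcount S = count S

  ecount : Sub n → ℕ
  ecount S = sumF λ i → count λ j → (i <F j) ∧ S i ∧ S j ∧ adj G i j

  edges : ℕ
  edges = ecount all

  triangles : ℕ
  triangles = sumF λ i → sumF λ j → count λ k →
    (i <F j) ∧ (j <F k) ∧ adj G i j ∧ adj G j k ∧ adj G i k

  -- Links.  lk v = N_v ; lk {u,w} = N_u ∩ N_w ; lk {u,w,x} = N_u ∩ N_w ∩ N_x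
  -- (as vertex sets; the link is the subgraph of G induced on them).

  lkV : Fin n → Sub n
  lkV v x = adj G v x

  lkE : Fin n → Fin n → Sub n
  lkE u w x = adj G u x ∧ adj G w x

  lkT : Fin n → Fin n → Fin n → Sub n
  lkT u w y x = adj G u x ∧ adj G w x ∧ adj G y x

  cycAdj : (k : ℕ) → Fin k → Fin k → Bool
  cycAdj k i j =
       (toℕ j ≡ᵇ suc (toℕ i)) ∨ (toℕ i ≡ᵇ suc (toℕ j))
    ∨ ((toℕ i ≡ᵇ 0) ∧ (toℕ j ≡ᵇ k ∸ 1))
    ∨ ((toℕ j ≡ᵇ 0) ∧ (toℕ i ≡ᵇ k ∸ 1))

  IsCycleOfLength : Sub n → ℕ → Set
  IsCycleOfLength S k =
    3 ≤ k ×
    Σ (Fin k → Fin n) λ f →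
      (∀ i j → f i ≡ f j → i ≡ j) ×
      (∀ x → S x ≡ true ⇔ (∃[ i ] f i ≡ x)) ×
      (∀ i j → adj G (f i) (f j) ≡ cycAdj k i j)

  IsCycle : Sub n → Set
  IsCycle S = ∃[ k ] IsCycleOfLength S k

  data Reach (S : Sub n) : Fin n → Fin n → Set where
    here : ∀ {x} → Reach S x x
    step : ∀ {x y z} → adj G x y ≡ true → S y ≡ true → Reach S y z → Reach S x z

  Connected : Sub n → Set
  Connected S = ∀ x y → S x ≡ true → S y ≡ true → Reach S x y

  -- G[S] is a planar graph all of whose faces are triangles.
  -- Planar embeddings are described combinatorially by rotation systems
  -- (combinatorial maps): for each vertex u of G[S], a cyclic permutation
  -- σ u of its neighbourhood in G[S].  Faces are the orbits of the dart
  -- permutation φ(u , w) = (w , σ w u).  The embedding is in the sphere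
  -- (i.e. planar) iff V − E + F = 2 (G[S] connected).

  InS : Sub n → Fin n → Fin n → Set
  InS S u w = S u ≡ true × S w ≡ true × adj G u w ≡ true

  iter : (Fin n → Fin n) → ℕ → Fin n → Fin n
  iter g zero    x = x
  iter g (suc k) x = g (iter g k x)

  record TriangulatedRotation (S : Sub n) : Set where
    field
      σ : Fin n → Fin n → Fin n
      σ-nbr  : ∀ u w → InS S u w → InS S u (σ u w)
      σ-inj  : ∀ u w w' → InS S u w → InS S u w' → σ u w ≡ σ u w' → w ≡ w'
      σ-cyc  : ∀ u w w' → InS S u w → InS S u w' → ∃[ k ] iter (σ u) k w ≡ w'
    φ : Fin n × Fin n → Fin n × Fin n
    φ (u , w) = (w , σ w u)
    field
      triangular : ∀ u w → InS S u w → φ (φ (φ (u , w))) ≡ (u , w)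
    -- number of faces: each (triangular) face {(u,w),(w,x),(x,u)} is counted
    -- once, via its dart (u , w) whose tail u is the smallest vertex of the face
    faces : ℕ
    faces = sumF λ u → count λ w →
      S u ∧ S w ∧ adj G u w ∧ (u <F w) ∧ (u <F σ w u)
    field
      euler : vcount S + faces ≡ ecount S + 2

  PlanarTriangulation : Sub n → Set
  PlanarTriangulation S = Connected S × TriangulatedRotation S

  record Fascinating : Set where
    field
      -- (a) #triangles = 2(m − n)   (stated without truncated subtraction)
      fa : triangles + 2 * n ≡ 2 * edges
      fb : ∀ u w → adj G u w ≡ true →
             ∃[ k ] (4 ≤ k × IsCycleOfLength (lkE u w) k)
      fc : ∀ u w y → adj G u w ≡ true → adj G w y ≡ true → adj G u y ≡ true →
             vcount (lkT u w y) ≡ 2 × ecount (lkT u w y) ≡ 0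
      fd : ∀ v → PlanarTriangulation (lkV v) × 6 ≤ vcount (lkV v)

  IsJoinOfTwoCycles : Set
  IsJoinOfTwoCycles =
    Σ (Sub n) λ A →
      IsCycle A × IsCycle (not ∘ A) ×
      (∀ a b → A a ≡ true → A b ≡ false → adj G a b ≡ true)

{-# OPTIONS --safe #-}
-- Euler's formula gives the link of a vertex of degree d exactly 3d − 6 edges, so an edge has fewer than
-- six common neighbours on average. Mantel's argument then finds an edge u w with at most three vertices
-- adjacent to neither end: the neighbourhood of w and its complement span only O(n) edges, and the density
-- forces all but O(n) pairs between them to be adjacent. After passing to a locally maximal cut S ⊔ ∁ S
-- every vertex has O(√n) neighbours on its own side.
--
-- If a vertex v has three neighbours on its own side, then counting the edges of its link shows that v and
-- these three together miss about n/2 vertices of the other side. The cut misses about n pairs, counted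
-- twice, so if every vertex misses fewer than n/10 vertices, all inner degrees are at most 2. The edge count
-- of a link then leaves no slack: each link is the suspension of a cycle that fills the other side, and G
-- is a join. If instead some vertex x misses at least n/10 vertices, then all inner degrees off x are at
-- most 2, and n² + 2n + 17 < 4m says that deg x exceeds the number of missing pairs off x by at least 6.
-- This contradicts the count of missing pairs inside the link of x, except when the link of x is a
-- suspension of a proper part of the other side; then connectedness of the cycles lk(st) makes every inner
-- edge s t miss that part or its complement, and again too many pairs are missing.
module Submission where

open import Defs hiding (all) renaming (sumF to ∑; sym to adj-sym; irrefl to adj-irrefl)
open import Data.Bool using (Bool; true; false; _∧_; _∨_; not; if_then_else_; T)
open import Data.Bool.Properties using (T-≡; ∧-comm; ∧-identityʳ; not-involutive)
open import Data.Empty using (⊥; ⊥-elim)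
open import Data.Fin using (Fin; toℕ)
import Data.Fin as F
open import Data.Fin.Induction using (<-weakInduction)
open import Data.Fin.Properties using (_≟_; any?; toℕ-inject₁; toℕ-injective)
open import Data.List using (List; []; _∷_; map; length)
import Data.List.Relation.Unary.All as All
import Data.List.Relation.Unary.AllPairs as AllPairs
open import Data.List.Relation.Unary.Unique.Propositional using (Unique)
open import Data.Nat using (ℕ; zero; suc; NonZero; _+_; _*_; _≤_; _<_; z≤n; s≤s; _≤ᵇ_; _<ᵇ_; _≡ᵇ_; _^_)
open import Data.Nat.ListAction using (sum)
open import Data.Nat.Properties hiding (_≟_)
open import Data.Nat.Tactic.RingSolver using (solve)
open import Data.Product using (∃-syntax; _×_; _,_; proj₁; proj₂)
open import Data.Sum using (_⊎_; inj₁; inj₂)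
open import Data.Unit using (tt)
open import Function using (_∘_; id; case_of_)
open import Function.Bundles using (mk⇔; Equivalence)
open import Relation.Binary.Definitions using (tri<; tri≈; tri>)
open import Relation.Binary.PropositionalEquality
open import Relation.Nullary using (¬_; Dec; yes; no; does; contradiction)

-- Pairs are counted in order, so an inner edge and a missing pair each count twice in
-- `∑ (inner G S)` and `∑ (miss G S)`. Fractions of `n` are multiplied out:
-- `40 * n ≤ 2 * (40 * opposite G S v) + n` says that the side opposite `v` has at least 39n/80
-- vertices. The obstacle is that averaging does not see a single vertex: one `x` can miss n/10
-- vertices without exceeding the budget of about `n` ordered missing pairs, and then none of the
-- bounds for typical vertices applies to it. The remaining vertices therefore have to be counted
-- exactly after `x` is removed, and the constant 17 is spent there. An excess of six of deg x over
-- the missing pairs off `x` is just what is needed: if `x` has `a` and `b` neighbours on the two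
-- sides, both at least three, then six yields (a - 3)(b - 3) ≤ -1, while five would only yield 0.
-- In turn 17 is just large enough for rounding to give six.

infixr 6 _⊕_
infixr 7 _⊗_

_⊕_ : ∀ {a b c d} → a ≤ b → c ≤ d → a + c ≤ b + d
_⊕_ = +-mono-≤

_⊗_ : ∀ {a b} k → a ≤ b → k * a ≤ k * b
k ⊗ p = *-monoʳ-≤ k p

-- Farkas certificates: p is a combination of the hypotheses, s the slack it leaves in the goal.
lin : ∀ {a b l r} s → a ≤ b → l + b + s ≡ r + a → l ≤ r
lin {a} {b} {l} {r} s p e =
  +-cancelʳ-≤ b l r (≤-trans (≤-trans (m≤m+n (l + b) s) (≤-reflexive e)) (+-monoʳ-≤ r p))

absurd : ∀ {a b} {A : Set} s → a ≤ b → 1 + b + s ≡ a → A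
absurd {a} {b} s p e = ⊥-elim (1+n≰n (≤-trans (≤-trans (m≤m+n (1 + b) s) (≤-reflexive e)) p))

2xy≤x²+y² : ∀ x y → 2 * (x * y) ≤ x * x + y * y
2xy≤x²+y² x y with ≤-total x y
... | inj₁ x≤y with m≤n⇒∃[o]m+o≡n x≤y
...   | d , refl = lin (d * d) (z≤n {0}) (solve (x ∷ d ∷ []))
2xy≤x²+y² x y | inj₂ y≤x with m≤n⇒∃[o]m+o≡n y≤x
...   | d , refl = lin (d * d) (z≤n {0}) (solve (y ∷ d ∷ []))

-- Booleans as numbers

𝟙 : Bool → ℕ
𝟙 b = if b then 1 else 0

𝟙-pos : ∀ {b} → 1 ≤ 𝟙 b → b ≡ true
𝟙-pos {true} _ = refl

𝟙-∧ : ∀ a b → 𝟙 (a ∧ b) ≡ 𝟙 a * 𝟙 b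
𝟙-∧ true  b = sym (+-identityʳ (𝟙 b))
𝟙-∧ false b = refl

𝟙≤1 : ∀ b → 𝟙 b ≤ 1
𝟙≤1 true  = ≤-refl
𝟙≤1 false = z≤n

∧-true : ∀ {a b} → a ∧ b ≡ true → a ≡ true × b ≡ true
∧-true {true} {true} _ = refl , refl

∧-intro : ∀ {a b} → a ≡ true → b ≡ true → a ∧ b ≡ true
∧-intro refl refl = refl

not-true : ∀ {a} → not a ≡ true → a ≡ false
not-true {false} _ = refl

not-false : ∀ {a} → not a ≡ false → a ≡ true
not-false {true} _ = refl

true≢false : ∀ {a} {A : Set} → a ≡ true → a ≡ false → A
true≢false refl ()

-- Inequalities between Boolean expressions are decided by evaluating all cases.
BoolFun : ℕ → Set
BoolFun zero    = ℕ × ℕ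
BoolFun (suc k) = Bool → BoolFun k

Valid : ∀ k → BoolFun k → Set
Valid zero    (l , r) = l ≤ r
Valid (suc k) f       = ∀ b → Valid k (f b)

check : ∀ k → BoolFun k → Bool
check zero    (l , r) = l ≤ᵇ r
check (suc k) f       = check k (f true) ∧ check k (f false)

bool≤ : ∀ k (f : BoolFun k) → check k f ≡ true → Valid k f
bool≤ zero    (l , r) c = ≤ᵇ⇒≤ l r (subst T (sym c) tt)
bool≤ (suc k) f       c true  = bool≤ k (f true)  (proj₁ (∧-true c))
bool≤ (suc k) f       c false = bool≤ k (f false) (proj₂ (∧-true {check k (f true)} c))

-- Finite sums

∑-cong : ∀ {n} {f g : Fin n → ℕ} → (∀ i → f i ≡ g i) → ∑ f ≡ ∑ g
∑-cong {zero}  e = refl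
∑-cong {suc n} e = cong₂ _+_ (e F.zero) (∑-cong (e ∘ F.suc))

∑-mono : ∀ {n} {f g : Fin n → ℕ} → (∀ i → f i ≤ g i) → ∑ f ≤ ∑ g
∑-mono {zero}  e = z≤n
∑-mono {suc n} e = +-mono-≤ (e F.zero) (∑-mono (e ∘ F.suc))

∑-+ : ∀ {n} (f g : Fin n → ℕ) → ∑ (λ i → f i + g i) ≡ ∑ f + ∑ g
∑-+ {zero}  f g = refl
∑-+ {suc n} f g = trans (cong (f F.zero + g F.zero +_) (∑-+ (f ∘ F.suc) (g ∘ F.suc)))
  (interchange (f F.zero) (g F.zero) (∑ (f ∘ F.suc)) (∑ (g ∘ F.suc)))
  where
  interchange : ∀ a b c d → a + b + (c + d) ≡ a + c + (b + d)
  interchange a b c d = solve (a ∷ b ∷ c ∷ d ∷ [])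

∑-* : ∀ {n} k (f : Fin n → ℕ) → ∑ (λ i → k * f i) ≡ k * ∑ f
∑-* {zero}  k f = sym (*-zeroʳ k)
∑-* {suc n} k f = trans (cong (k * f F.zero +_) (∑-* k (f ∘ F.suc)))
  (sym (*-distribˡ-+ k (f F.zero) (∑ (f ∘ F.suc))))

∑-*ʳ : ∀ {n} k (f : Fin n → ℕ) → ∑ (λ i → f i * k) ≡ ∑ f * k
∑-*ʳ k f = trans (∑-cong (λ i → *-comm (f i) k)) (trans (∑-* k f) (*-comm k (∑ f)))

∑-0 : ∀ n → ∑ {n} (λ _ → 0) ≡ 0
∑-0 zero    = refl
∑-0 (suc n) = ∑-0 n

∑-const : ∀ n k → ∑ {n} (λ _ → k) ≡ n * k
∑-const zero    k = refl
∑-const (suc n) k = cong (k +_) (∑-const n k)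

∑-swap : ∀ {m n} (f : Fin m → Fin n → ℕ) →
         ∑ (λ i → ∑ (λ j → f i j)) ≡ ∑ (λ j → ∑ (λ i → f i j))
∑-swap {zero}  {n} f = sym (∑-0 n)
∑-swap {suc m} f = trans (cong (∑ (f F.zero) +_) (∑-swap (f ∘ F.suc)))
  (sym (∑-+ (f F.zero) (λ j → ∑ (λ i → f (F.suc i) j))))

∑-≥ : ∀ {n} (f : Fin n → ℕ) i → f i ≤ ∑ f
∑-≥ f F.zero    = m≤m+n (f F.zero) _
∑-≥ f (F.suc i) = ≤-trans (∑-≥ (f ∘ F.suc) i) (m≤n+m _ (f F.zero))

-- The equality case of a termwise estimate: where an edge count leaves no slack, it turns a
-- comparison of totals into an identity at every vertex.
∑-tight : ∀ {n} {f g : Fin n → ℕ} → (∀ i → f i ≤ g i) → ∑ g ≤ ∑ f → ∀ i → f i ≡ g i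
∑-tight {suc n} {f} {g} f≤g h i = ≤-antisym (f≤g i) (pointwise i)
  where
  tail≤ : ∑ (f ∘ F.suc) ≤ ∑ (g ∘ F.suc)
  tail≤ = ∑-mono (f≤g ∘ F.suc)
  pointwise : ∀ i → g i ≤ f i
  pointwise F.zero    = +-cancelʳ-≤ (∑ (g ∘ F.suc)) _ _ (≤-trans h (+-monoʳ-≤ (f F.zero) tail≤))
  pointwise (F.suc i) = ≤-reflexive (sym (∑-tight (f≤g ∘ F.suc)
    (+-cancelˡ-≤ (g F.zero) _ _ (≤-trans h (+-monoˡ-≤ _ (f≤g F.zero)))) i))

∑-pos : ∀ {n} (f : Fin n → ℕ) → 1 ≤ ∑ f → ∃[ i ] 1 ≤ f i
∑-pos {suc n} f h with f F.zero in eq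
... | suc k = F.zero , subst (1 ≤_) (sym eq) (s≤s z≤n)
... | zero  with ∑-pos (f ∘ F.suc) h
...   | i , p = F.suc i , p

∑-<⇒∃ : ∀ {n} (f g : Fin n → ℕ) → ∑ f < ∑ g → ∃[ i ] f i < g i
∑-<⇒∃ {suc n} f g h with <-≤-connex (f F.zero) (g F.zero)
... | inj₁ lt = F.zero , lt
... | inj₂ ge with ∑-<⇒∃ (f ∘ F.suc) (g ∘ F.suc) tail<
  where
  tail< : ∑ (f ∘ F.suc) < ∑ (g ∘ F.suc)
  tail< = +-cancelˡ-< (f F.zero) _ _ (<-≤-trans h (+-monoˡ-≤ _ ge))
...   | i , p = F.suc i , p

_==_ : ∀ {n} → Fin n → Fin n → Bool
i == j = does (i ≟ j)

==⇒≡ : ∀ {n} (i j : Fin n) → (i == j) ≡ true → i ≡ j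
==⇒≡ i j e with i ≟ j
... | yes p = p

==-refl : ∀ {n} (i : Fin n) → (i == i) ≡ true
==-refl i with i ≟ i
... | yes _ = refl
... | no ¬p = contradiction refl ¬p

≢⇒== : ∀ {n} {i j : Fin n} → i ≢ j → (i == j) ≡ false
≢⇒== {_} {i} {j} ne with i ≟ j
... | yes p = contradiction p ne
... | no _  = refl

==⇒≢ : ∀ {n} {i j : Fin n} → (i == j) ≡ false → i ≢ j
==⇒≢ {_} {i} e refl = true≢false (==-refl i) e

∑-δ : ∀ {n} (i : Fin n) (f : Fin n → ℕ) → ∑ (λ j → 𝟙 (i == j) * f j) ≡ f i
∑-δ {suc n} F.zero f = trans (cong₂ _+_ (+-identityʳ (f F.zero)) (∑-0 n)) (+-identityʳ (f F.zero))
∑-δ {suc n} (F.suc i) f = ∑-δ i (f ∘ F.suc)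

∑-split : ∀ {n} (i : Fin n) (f : Fin n → ℕ) → ∑ f ≡ f i + ∑ (λ j → 𝟙 (not (i == j)) * f j)
∑-split i f = trans (∑-cong pw) (trans (∑-+ (λ j → 𝟙 (i == j) * f j) (λ j → 𝟙 (not (i == j)) * f j))
  (cong (_+ ∑ (λ j → 𝟙 (not (i == j)) * f j)) (∑-δ i f)))
  where
  pw : ∀ j → f j ≡ 𝟙 (i == j) * f j + 𝟙 (not (i == j)) * f j
  pw j with i == j
  ... | true  = sym (trans (+-identityʳ (f j + 0)) (+-identityʳ (f j)))
  ... | false = sym (+-identityʳ (f j))

-- Counting

count-cong : ∀ {n} {p q : Fin n → Bool} → (∀ i → p i ≡ q i) → count p ≡ count q
count-cong e = ∑-cong (cong 𝟙 ∘ e)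

count-mono : ∀ {n} {p q : Fin n → Bool} → (∀ i → p i ≡ true → q i ≡ true) → count p ≤ count q
count-mono {_} {p} {q} h = ∑-mono pw
  where
  pw : ∀ i → 𝟙 (p i) ≤ 𝟙 (q i)
  pw i with p i in e
  ... | false = z≤n
  ... | true rewrite h i e = ≤-refl

count-all : ∀ n → count {n} (λ _ → true) ≡ n
count-all n = trans (∑-const n 1) (*-identityʳ n)

count≤n : ∀ {n} (p : Fin n → Bool) → count p ≤ n
count≤n {n} p = ≤-trans (count-mono {n} {p} {λ _ → true} (λ _ _ → refl)) (≤-reflexive (count-all n))

count-not : ∀ {n} (p : Fin n → Bool) → count p + count (not ∘ p) ≡ n
count-not {n} p = trans (sym (∑-+ (𝟙 ∘ p) (𝟙 ∘ not ∘ p))) (trans (∑-cong (pw ∘ p)) (count-all n))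
  where
  pw : ∀ b → 𝟙 b + 𝟙 (not b) ≡ 1
  pw true = refl
  pw false = refl

_∖_ : ∀ {n} → (Fin n → Bool) → Fin n → Fin n → Bool
(p ∖ i) j = p j ∧ not (i == j)

count-∖ : ∀ {n} (p : Fin n → Bool) i → count p ≡ 𝟙 (p i) + count (p ∖ i)
count-∖ p i = trans (∑-split i (𝟙 ∘ p)) (cong (𝟙 (p i) +_) (∑-cong pw))
  where
  pw : ∀ j → 𝟙 (not (i == j)) * 𝟙 (p j) ≡ 𝟙 ((p ∖ i) j)
  pw j = trans (*-comm (𝟙 (not (i == j))) (𝟙 (p j))) (sym (𝟙-∧ (p j) (not (i == j))))

count-pick : ∀ {n} (p : Fin n → Bool) {k} → suc k ≤ count p → ∃[ i ] (p i ≡ true × k ≤ count (p ∖ i))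
count-pick p {k} h with ∑-pos (𝟙 ∘ p) (≤-trans (s≤s z≤n) h)
... | i , pos = i , 𝟙-pos pos ,
  +-cancelˡ-≤ 1 _ _ (≤-trans h (≤-reflexive (trans (count-∖ p i) (cong (λ b → 𝟙 b + count (p ∖ i)) (𝟙-pos pos)))))

∖-true : ∀ {n} (p : Fin n → Bool) i j → (p ∖ i) j ≡ true → p j ≡ true × i ≢ j
∖-true p i j h = proj₁ (∧-true h) , ==⇒≢ (not-true (proj₂ (∧-true {p j} h)))

record Three {n} (p : Fin n → Bool) : Set where
  constructor three
  field
    {w₁ w₂ w₃} : Fin n
    p₁  : p w₁ ≡ true
    p₂  : p w₂ ≡ true
    p₃  : p w₃ ≡ true
    w₁₂ : w₁ ≢ w₂
    w₁₃ : w₁ ≢ w₃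
    w₂₃ : w₂ ≢ w₃

count-three : ∀ {n} (p : Fin n → Bool) → 3 ≤ count p → Three p
count-three p h with count-pick p h
... | i , pi , h₁ with count-pick (p ∖ i) h₁
...   | j , pj , h₂ with count-pick ((p ∖ i) ∖ j) h₂
...     | k , pk , _ with ∖-true p i j pj | ∖-true (p ∖ i) j k pk
...       | pj′ , i≢j | pk′ , j≢k with ∖-true p i k pk′
...         | pk″ , i≢k = three pi pj′ pk″ i≢j i≢k j≢k

∑∑-mono : ∀ {m n} {f g : Fin m → Fin n → ℕ} → (∀ i j → f i j ≤ g i j) →
          ∑ (λ i → ∑ (f i)) ≤ ∑ (λ i → ∑ (g i))
∑∑-mono h = ∑-mono λ i → ∑-mono (h i)

∑∑-cong : ∀ {m n} {f g : Fin m → Fin n → ℕ} → (∀ i j → f i j ≡ g i j) →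
          ∑ (λ i → ∑ (f i)) ≡ ∑ (λ i → ∑ (g i))
∑∑-cong h = ∑-cong λ i → ∑-cong (h i)

∑∑-+ : ∀ {m n} (f g : Fin m → Fin n → ℕ) →
       ∑ (λ i → ∑ λ j → f i j + g i j) ≡ ∑ (λ i → ∑ (f i)) + ∑ (λ i → ∑ (g i))
∑∑-+ f g = trans (∑-cong λ i → ∑-+ (f i) (g i)) (∑-+ (λ i → ∑ (f i)) (λ i → ∑ (g i)))

count-unique : ∀ {n} (p : Fin n → Bool) →
               (∀ i j → p i ≡ true → p j ≡ true → i ≡ j) → count p ≤ 1
count-unique p uniq = ≮⇒≥ λ 2≤ → case count-pick p 2≤ of λ where
  (i , pi , 1≤) → case count-pick (p ∖ i) 1≤ of λ where
    (j , pj , _) → let pj′ , i≢j = ∖-true p i j pj in i≢j (uniq i j pi pj′)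

-- A fibre of `f` within `P` has at most one point, and none lies over a point outside `P`. The
-- inequality suffices for the darts of a triangulation: their face permutation has order three, so
-- three applications close up to an equality.
∑-reindex : ∀ {n} (P : Fin n → Bool) (f : Fin n → Fin n) (h : Fin n → ℕ) →
  (∀ x → P x ≡ true → P (f x) ≡ true) →
  (∀ x y → P x ≡ true → P y ≡ true → f x ≡ f y → x ≡ y) →
  ∑ (λ x → 𝟙 (P x) * h (f x)) ≤ ∑ (λ x → 𝟙 (P x) * h x)
∑-reindex {n} P f h closed inj = begin
  ∑ (λ x → 𝟙 (P x) * h (f x))
    ≡⟨ ∑-cong (λ x → sym (∑-δ (f x) (λ y → 𝟙 (P x) * h y))) ⟩
  ∑ (λ x → ∑ λ y → 𝟙 (f x == y) * (𝟙 (P x) * h y))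
    ≡⟨ ∑-swap (λ x y → 𝟙 (f x == y) * (𝟙 (P x) * h y)) ⟩
  ∑ (λ y → ∑ λ x → 𝟙 (f x == y) * (𝟙 (P x) * h y))
    ≡⟨ ∑-cong (λ y → trans (∑-cong λ x → regroup (f x == y) (P x) (h y))
                           (∑-*ʳ (h y) (λ x → 𝟙 (fibre y x)))) ⟩
  ∑ (λ y → count (fibre y) * h y)
    ≤⟨ ∑-mono (λ y → *-monoˡ-≤ (h y) (fibre≤ y)) ⟩
  ∑ (λ y → 𝟙 (P y) * h y) ∎
  where
  open ≤-Reasoning
  fibre : Fin n → Fin n → Bool
  fibre y x = (f x == y) ∧ P x
  regroup : ∀ a b c → 𝟙 a * (𝟙 b * c) ≡ 𝟙 (a ∧ b) * c
  regroup true  b c = +-identityʳ (𝟙 b * c)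
  regroup false b c = refl
  fibre≤ : ∀ y → count (fibre y) ≤ 𝟙 (P y)
  fibre≤ y with P y in Py
  ... | true  = count-unique (fibre y) λ i j fi fj →
    let fi≡y , Pi = ∧-true {f i == y} fi ; fj≡y , Pj = ∧-true {f j == y} fj
    in inj i j Pi Pj (trans (==⇒≡ (f i) y fi≡y) (sym (==⇒≡ (f j) y fj≡y)))
  ... | false = ≮⇒≥ λ 1≤ → case count-pick (fibre y) 1≤ of λ where
    (i , fi , _) → let fi≡y , Pi = ∧-true {f i == y} fi in
      true≢false (closed i Pi) (trans (cong P (==⇒≡ (f i) y fi≡y)) Py)

<ᵇ-true : ∀ {a b} → a < b → (a <ᵇ b) ≡ true
<ᵇ-true p = Equivalence.to T-≡ (<⇒<ᵇ p)

<ᵇ-false : ∀ {a b} → b ≤ a → (a <ᵇ b) ≡ false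
<ᵇ-false {a} {b} p with a <ᵇ b in e
... | false = refl
... | true  = contradiction (<-≤-trans (<ᵇ⇒< a b (Equivalence.from T-≡ e)) p) (<-irrefl refl)

<ᵇ-total : ∀ {a b} → a ≢ b → 𝟙 (a <ᵇ b) + 𝟙 (b <ᵇ a) ≡ 1
<ᵇ-total {a} {b} ne with <-cmp a b
... | tri< p _ _ rewrite <ᵇ-true p | <ᵇ-false (<⇒≤ p) = refl
... | tri≈ _ p _ = contradiction p ne
... | tri> _ _ p rewrite <ᵇ-true p | <ᵇ-false (<⇒≤ p) = refl

-- The comparisons have the shape that `faces` takes when its dart is rotated round a triangle. Two
-- of the eight sign patterns are cyclic chains and impossible.
unique-min : ∀ {a b c} → a ≢ b → b ≢ c → c ≢ a →
  𝟙 ((a <ᵇ b) ∧ (a <ᵇ c)) + 𝟙 ((b <ᵇ c) ∧ (b <ᵇ a)) + 𝟙 ((c <ᵇ a) ∧ (c <ᵇ b)) ≡ 1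
unique-min {a} {b} {c} ab bc ca with <-cmp a b | <-cmp b c | <-cmp c a
... | tri≈ _ p _ | _ | _ = contradiction p ab
... | _ | tri≈ _ p _ | _ = contradiction p bc
... | _ | _ | tri≈ _ p _ = contradiction p ca
... | tri< p _ _ | tri< q _ _ | tri< r _ _ = contradiction (<-trans p (<-trans q r)) (<-irrefl refl)
... | tri> _ _ p | tri> _ _ q | tri> _ _ r = contradiction (<-trans r (<-trans q p)) (<-irrefl refl)
... | tri< p _ _ | tri< q _ _ | tri> _ _ r
  rewrite <ᵇ-true p | <ᵇ-false (<⇒≤ p) | <ᵇ-true q | <ᵇ-false (<⇒≤ q) | <ᵇ-true r | <ᵇ-false (<⇒≤ r) = refl
... | tri< p _ _ | tri> _ _ q | tri< r _ _
  rewrite <ᵇ-true p | <ᵇ-false (<⇒≤ p) | <ᵇ-true q | <ᵇ-false (<⇒≤ q) | <ᵇ-true r | <ᵇ-false (<⇒≤ r) = refl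
... | tri> _ _ p | tri< q _ _ | tri< r _ _
  rewrite <ᵇ-true p | <ᵇ-false (<⇒≤ p) | <ᵇ-true q | <ᵇ-false (<⇒≤ q) | <ᵇ-true r = refl
... | tri< p _ _ | tri> _ _ q | tri> _ _ r
  rewrite <ᵇ-true p | <ᵇ-false (<⇒≤ p) | <ᵇ-true q | <ᵇ-false (<⇒≤ q) | <ᵇ-true r | <ᵇ-false (<⇒≤ r) = refl
... | tri> _ _ p | tri< q _ _ | tri> _ _ r
  rewrite <ᵇ-true p | <ᵇ-false (<⇒≤ p) | <ᵇ-true q | <ᵇ-false (<⇒≤ q) | <ᵇ-false (<⇒≤ r) = refl
... | tri> _ _ p | tri> _ _ q | tri< r _ _
  rewrite <ᵇ-true p | <ᵇ-false (<⇒≤ p) | <ᵇ-true q | <ᵇ-false (<⇒≤ q) | <ᵇ-true r = refl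

-- Vertex sets and counts of ordered pairs

_∩_ : ∀ {n} → Sub n → Sub n → Sub n
(P ∩ Q) x = P x ∧ Q x

∁ : ∀ {n} → Sub n → Sub n
∁ P x = not (P x)

∩-⊆ˡ : ∀ {n} (P Q : Sub n) x → (P ∩ Q) x ≡ true → P x ≡ true
∩-⊆ˡ P Q x h = proj₁ (∧-true h)

∩-⊆ʳ : ∀ {n} (P Q : Sub n) x → (P ∩ Q) x ≡ true → Q x ≡ true
∩-⊆ʳ P Q x h = proj₂ (∧-true {P x} h)

everything : ∀ {n} → Sub n
everything _ = true

𝟙-swap : ∀ a b c → 𝟙 (a ∧ b ∧ c) ≡ 𝟙 (b ∧ a ∧ c)
𝟙-swap true  true  c = refl
𝟙-swap true  false c = refl
𝟙-swap false true  c = refl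
𝟙-swap false false c = refl

module _ {n : ℕ} (G : Graph n) where

  -- Ordered pairs: `e P P` counts each edge inside `P` twice, whereas each edge between disjoint
  -- `P` and `Q` is counted once. In `ē` a vertex of both sets also pairs with itself.
  e ē : Sub n → Sub n → ℕ
  e P Q = ∑ λ x → ∑ λ y → 𝟙 (P x ∧ Q y ∧ adj G x y)
  ē P Q = ∑ λ x → ∑ λ y → 𝟙 (P x ∧ Q y ∧ not (adj G x y))

  deg : Fin n → ℕ
  deg v = count (adj G v)

  adj⇒≢ : ∀ {x y} → adj G x y ≡ true → x ≢ y
  adj⇒≢ {x} a refl = true≢false a (adj-irrefl G x)

  e-sym : ∀ P Q → e P Q ≡ e Q P
  e-sym P Q = trans (∑-swap (λ x y → 𝟙 (P x ∧ Q y ∧ adj G x y))) (∑∑-cong pw)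
    where
    pw : ∀ y x → 𝟙 (P x ∧ Q y ∧ adj G x y) ≡ 𝟙 (Q y ∧ P x ∧ adj G y x)
    pw y x rewrite adj-sym G x y = 𝟙-swap (P x) (Q y) (adj G y x)

  e+ē : ∀ P Q → e P Q + ē P Q ≡ count P * count Q
  e+ē P Q = begin
    e P Q + ē P Q
      ≡⟨ sym (∑∑-+ (λ x y → 𝟙 (P x ∧ Q y ∧ adj G x y)) (λ x y → 𝟙 (P x ∧ Q y ∧ not (adj G x y)))) ⟩
    ∑ (λ x → ∑ λ y → 𝟙 (P x ∧ Q y ∧ adj G x y) + 𝟙 (P x ∧ Q y ∧ not (adj G x y)))
      ≡⟨ ∑∑-cong (λ x y → pw (P x) (Q y) (adj G x y)) ⟩
    ∑ (λ x → ∑ λ y → 𝟙 (P x) * 𝟙 (Q y))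
      ≡⟨ ∑-cong (λ x → ∑-* (𝟙 (P x)) (𝟙 ∘ Q)) ⟩
    ∑ (λ x → 𝟙 (P x) * count Q)
      ≡⟨ ∑-*ʳ (count Q) (𝟙 ∘ P) ⟩
    count P * count Q ∎
    where
    open ≡-Reasoning
    pw : ∀ a b c → 𝟙 (a ∧ b ∧ c) + 𝟙 (a ∧ b ∧ not c) ≡ 𝟙 a * 𝟙 b
    pw true  true  true  = refl
    pw true  true  false = refl
    pw true  false c     = refl
    pw false b     c     = refl

  e-rows : ∀ P Q → e P Q ≡ ∑ λ x → 𝟙 (P x) * count (Q ∩ adj G x)
  e-rows P Q = ∑-cong λ x → trans (∑-cong λ y → 𝟙-∧ (P x) (Q y ∧ adj G x y)) (∑-* (𝟙 (P x)) (𝟙 ∘ (Q ∩ adj G x)))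

  ē-rows : ∀ P Q → ē P Q ≡ ∑ λ x → 𝟙 (P x) * count (Q ∩ ∁ (adj G x))
  ē-rows P Q = ∑-cong λ x → trans (∑-cong λ y → 𝟙-∧ (P x) (Q y ∧ not (adj G x y))) (∑-* (𝟙 (P x)) (𝟙 ∘ (Q ∩ ∁ (adj G x))))

  e-≤ : ∀ P Q k → (∀ x → P x ≡ true → count (Q ∩ adj G x) ≤ k) → e P Q ≤ k * count P
  e-≤ P Q k h = ≤-trans (≤-reflexive (e-rows P Q)) (≤-trans (∑-mono pw) (≤-reflexive (∑-* k (𝟙 ∘ P))))
    where
    pw : ∀ x → 𝟙 (P x) * count (Q ∩ adj G x) ≤ k * 𝟙 (P x)
    pw x with P x in Px
    ... | false = z≤n
    ... | true  = ≤-trans (≤-reflexive (+-identityʳ _)) (≤-trans (h x Px) (≤-reflexive (sym (*-identityʳ k))))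

  e-mono : ∀ P P′ Q Q′ → (∀ x → P x ≡ true → P′ x ≡ true) → (∀ x → Q x ≡ true → Q′ x ≡ true) →
           e P Q ≤ e P′ Q′
  e-mono P P′ Q Q′ p q = ∑∑-mono pw
    where
    pw : ∀ x y → 𝟙 (P x ∧ Q y ∧ adj G x y) ≤ 𝟙 (P′ x ∧ Q′ y ∧ adj G x y)
    pw x y with P x in Px | Q y in Qy
    ... | false | _     = z≤n
    ... | true  | false = z≤n
    ... | true  | true  rewrite p x Px | q y Qy = ≤-refl

  e-splitˡ : ∀ P Q R → e P Q ≡ e (P ∩ R) Q + e (P ∩ ∁ R) Q
  e-splitˡ P Q R = trans (∑∑-cong (λ x y → pw (P x) (R x) (Q y ∧ adj G x y)))
    (∑∑-+ (λ x y → 𝟙 ((P ∩ R) x ∧ Q y ∧ adj G x y)) (λ x y → 𝟙 ((P ∩ ∁ R) x ∧ Q y ∧ adj G x y)))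
    where
    pw : ∀ a b c → 𝟙 (a ∧ c) ≡ 𝟙 ((a ∧ b) ∧ c) + 𝟙 ((a ∧ not b) ∧ c)
    pw true  true  c = sym (+-identityʳ (𝟙 c))
    pw true  false c = refl
    pw false b     c = refl

  e-splitʳ : ∀ P Q R → e P Q ≡ e P (Q ∩ R) + e P (Q ∩ ∁ R)
  e-splitʳ P Q R = trans (e-sym P Q) (trans (e-splitˡ Q P R)
    (cong₂ _+_ (e-sym (Q ∩ R) P) (e-sym (Q ∩ ∁ R) P)))

  e-split : ∀ P R → e P P ≡ e (P ∩ R) (P ∩ R) + 2 * e (P ∩ R) (P ∩ ∁ R) + e (P ∩ ∁ R) (P ∩ ∁ R)
  e-split P R
    rewrite e-splitˡ P P R | e-splitʳ (P ∩ R) P R | e-splitʳ (P ∩ ∁ R) P R | e-sym (P ∩ ∁ R) (P ∩ R)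
    = regroup (e (P ∩ R) (P ∩ R)) (e (P ∩ R) (P ∩ ∁ R)) (e (P ∩ ∁ R) (P ∩ ∁ R))
    where
    regroup : ∀ a b c → a + b + (b + c) ≡ a + 2 * b + c
    regroup a b c = solve (a ∷ b ∷ c ∷ [])

  handshake : ∀ S → e S S ≡ 2 * ecount G S
  handshake S = begin
    e S S
      ≡⟨ ∑∑-cong pw ⟩
    ∑ (λ i → ∑ λ j → up i j + up j i)
      ≡⟨ ∑∑-+ up (λ i j → up j i) ⟩
    ecount G S + ∑ (λ i → ∑ λ j → up j i)
      ≡⟨ cong (ecount G S +_) (trans (∑-swap (λ i j → up j i)) (sym (+-identityʳ _))) ⟩
    2 * ecount G S ∎
    where
    open ≡-Reasoning
    up : Fin n → Fin n → ℕ
    up i j = 𝟙 ((i <F j) ∧ S i ∧ S j ∧ adj G i j)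
    distribute : ∀ a b p q c → (c ≡ true → 𝟙 p + 𝟙 q ≡ 1) →
                 𝟙 (a ∧ b ∧ c) ≡ 𝟙 (p ∧ a ∧ b ∧ c) + 𝟙 (q ∧ b ∧ a ∧ c)
    distribute true  true  true  false true  _ = refl
    distribute true  true  false true  true  _ = refl
    distribute true  true  true  true  true  h = contradiction (h refl) λ ()
    distribute true  true  false false true  h = contradiction (h refl) λ ()
    distribute true  true  true  true  false _ = refl
    distribute true  true  true  false false _ = refl
    distribute true  true  false true  false _ = refl
    distribute true  true  false false false _ = refl
    distribute true  false true  true  c _ = refl
    distribute true  false true  false c _ = refl
    distribute true  false false true  c _ = refl
    distribute true  false false false c _ = refl
    distribute false true  true  true  c _ = refl
    distribute false true  true  false c _ = refl
    distribute false true  false true  c _ = refl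
    distribute false true  false false c _ = refl
    distribute false false true  true  c _ = refl
    distribute false false true  false c _ = refl
    distribute false false false true  c _ = refl
    distribute false false false false c _ = refl
    pw : ∀ i j → 𝟙 (S i ∧ S j ∧ adj G i j) ≡ up i j + up j i
    pw i j rewrite adj-sym G j i = distribute (S i) (S j) (i <F j) (j <F i) (adj G i j)
      λ a → <ᵇ-total (adj⇒≢ a ∘ toℕ-injective)

  -- Euler's formula for a triangulated rotation system

  module _ {S : Sub n} (tr : TriangulatedRotation G S) where
    open TriangulatedRotation tr

    private
      D : Fin n → Fin n → Bool
      D u w = S u ∧ S w ∧ adj G u w

      D⇒InS : ∀ {u w} → D u w ≡ true → InS G S u w
      D⇒InS {u} {w} d = let s , d′ = ∧-true {S u} d ; t , a = ∧-true {S w} d′ in s , t , a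

      InS⇒D : ∀ {u w} → InS G S u w → D u w ≡ true
      InS⇒D (s , t , a) = ∧-intro s (∧-intro t a)

      InS-sym : ∀ {u w} → InS G S u w → InS G S w u
      InS-sym {u} {w} (s , t , a) = t , s , trans (adj-sym G w u) a

      D-sym : ∀ u w → D u w ≡ D w u
      D-sym u w with D u w in p | D w u in q
      ... | true  | true  = refl
      ... | false | false = refl
      ... | true  | false = true≢false (InS⇒D (InS-sym (D⇒InS p))) q
      ... | false | true  = true≢false (InS⇒D (InS-sym (D⇒InS q))) p

      ∑D : (Fin n → Fin n → ℕ) → ℕ
      ∑D h = ∑ λ u → ∑ λ w → 𝟙 (D u w) * h u w

      -- Composition with the face permutation `φ`: each dart is weighed by the next dart of its
      -- face.
      shift : (Fin n → Fin n → ℕ) → Fin n → Fin n → ℕ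
      shift h u w = h w (σ w u)

      ∑D-shift : ∀ h → ∑D (shift h) ≤ ∑D h
      ∑D-shift h = begin
        ∑D (shift h)
          ≡⟨ ∑-swap (λ u w → 𝟙 (D u w) * h w (σ w u)) ⟩
        ∑ (λ w → ∑ λ u → 𝟙 (D u w) * h w (σ w u))
          ≤⟨ ∑-mono (λ w → ∑-reindex (λ u → D u w) (σ w) (h w)
               (λ u d → InS⇒D (InS-sym (σ-nbr w u (InS-sym (D⇒InS d)))))
               (λ u u′ d d′ → σ-inj w u u′ (InS-sym (D⇒InS d)) (InS-sym (D⇒InS d′)))) ⟩
        ∑ (λ w → ∑ λ u → 𝟙 (D u w) * h w u)
          ≡⟨ ∑∑-cong (λ w u → cong (λ b → 𝟙 b * h w u) (D-sym u w)) ⟩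
        ∑D h ∎
        where open ≤-Reasoning

      lowest : Fin n → Fin n → ℕ
      lowest u w = 𝟙 ((u <F w) ∧ (u <F σ w u))

      -- The three darts of a face have distinct tails, exactly one of which is the smallest.
      one-lowest : ∀ u w → 𝟙 (D u w) ≡
        𝟙 (D u w) * (lowest u w + shift lowest u w + shift (shift lowest) u w)
      one-lowest u w with D u w in d
      ... | false = refl
      ... | true
        with uw ← D⇒InS d | wx ← σ-nbr w u (InS-sym (D⇒InS d)) | tri ← triangular u w (D⇒InS d)
        with u≡ ← cong proj₁ tri | w≡ ← cong proj₂ tri
        with xu ← subst (InS G S (σ w u)) u≡ (σ-nbr (σ w u) w (InS-sym wx))
        rewrite u≡ | w≡ = sym (trans (+-identityʳ _) (unique-min
          (distinct uw) (distinct wx) (distinct xu)))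
        where
        distinct : ∀ {x y} → InS G S x y → toℕ x ≢ toℕ y
        distinct (_ , _ , a) = adj⇒≢ a ∘ toℕ-injective

      shift³ : ∀ h → ∑D h ≡ ∑D (shift (shift (shift h)))
      shift³ h = ∑∑-cong pw
        where
        pw : ∀ u w → 𝟙 (D u w) * h u w ≡ 𝟙 (D u w) * shift (shift (shift h)) u w
        pw u w with D u w in d
        ... | false = refl
        ... | true  = cong (λ p → h (proj₁ p) (proj₂ p) + 0) (sym (triangular u w (D⇒InS d)))

      faces≡ : faces ≡ ∑D lowest
      faces≡ = ∑∑-cong λ u w → pw (S u) (S w) (adj G u w) ((u <F w) ∧ (u <F σ w u))
        where
        pw : ∀ a b c d → 𝟙 (a ∧ b ∧ c ∧ d) ≡ 𝟙 (a ∧ b ∧ c) * 𝟙 d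
        pw true  true  c d = 𝟙-∧ c d
        pw true  false c d = refl
        pw false b     c d = refl

    -- By `one-lowest` each dart is counted by exactly one of `lowest` and its two shifts, so the
    -- three totals add up to the number of darts. They are equal because the inequalities of
    -- `∑D-shift` form a chain that `shift³` closes.
    3*faces : 3 * faces ≡ e S S
    3*faces = begin
      3 * faces
        ≡⟨ cong (3 *_) faces≡ ⟩
      3 * ∑D lowest
        ≡⟨ triple (∑D lowest) ⟩
      ∑D lowest + ∑D lowest + ∑D lowest
        ≡⟨ cong₂ (λ a b → ∑D lowest + a + b) (sym s₁) (sym s₂) ⟩
      ∑D lowest + ∑D (shift lowest) + ∑D (shift (shift lowest))
        ≡⟨ sym (trans (∑D-+ (λ u w → lowest u w + shift lowest u w) (shift (shift lowest)))
                      (cong (_+ ∑D (shift (shift lowest))) (∑D-+ lowest (shift lowest)))) ⟩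
      ∑D (λ u w → lowest u w + shift lowest u w + shift (shift lowest) u w)
        ≡⟨ sym (∑∑-cong one-lowest) ⟩
      e S S ∎
      where
      open ≡-Reasoning
      triple : ∀ a → 3 * a ≡ a + a + a
      triple a = solve (a ∷ [])
      ∑D-+ : ∀ f g → ∑D (λ u w → f u w + g u w) ≡ ∑D f + ∑D g
      ∑D-+ f g = trans (∑∑-cong λ u w → *-distribˡ-+ (𝟙 (D u w)) (f u w) (g u w))
        (∑∑-+ (λ u w → 𝟙 (D u w) * f u w) (λ u w → 𝟙 (D u w) * g u w))
      s₁ : ∑D (shift lowest) ≡ ∑D lowest
      s₁ = ≤-antisym (∑D-shift lowest) (≤-trans (≤-reflexive (shift³ lowest))
        (≤-trans (∑D-shift (shift (shift lowest))) (∑D-shift (shift lowest))))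
      s₂ : ∑D (shift (shift lowest)) ≡ ∑D lowest
      s₂ = ≤-antisym (≤-trans (∑D-shift (shift lowest)) (∑D-shift lowest))
        (≤-trans (≤-reflexive (shift³ lowest)) (∑D-shift (shift (shift lowest))))

    -- V - E + F = 2 with 3F = 2E gives E = 3V - 6, doubled here because `e S S` is 2E.
    triangulation-edges : e S S + 12 ≡ 6 * count S
    triangulation-edges = arith (count S) faces (ecount G S) (e S S) euler (handshake S) 3*faces
      where
      arith : ∀ V F E D → V + F ≡ E + 2 → D ≡ 2 * E → 3 * F ≡ D → D + 12 ≡ 6 * V
      arith V F E D h refl k = +-cancelʳ-≡ (6 * F) _ _ (trans (cong ((2 * E + 12) +_) (6F F))
          (trans (cong (λ x → 2 * E + 12 + 2 * x) k) (trans (regroup E) (trans (cong (6 *_) (sym h)) (distr V F)))))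
        where
        6F : ∀ F → 6 * F ≡ 2 * (3 * F)
        6F F = solve (F ∷ [])
        regroup : ∀ E → 2 * E + 12 + 2 * (2 * E) ≡ 6 * (E + 2)
        regroup E = solve (E ∷ [])
        distr : ∀ V F → 6 * (V + F) ≡ 6 * V + 6 * F
        distr V F = solve (V ∷ F ∷ [])

-- Inclusion-exclusion and the Cauchy-Schwarz inequality

count-split : ∀ {n} (p R : Sub n) → count p ≡ count (p ∩ R) + count (p ∩ ∁ R)
count-split p R = trans (∑-cong λ x → pw (p x) (R x)) (∑-+ (𝟙 ∘ (p ∩ R)) (𝟙 ∘ (p ∩ ∁ R)))
  where
  pw : ∀ a b → 𝟙 a ≡ 𝟙 (a ∧ b) + 𝟙 (a ∧ not b)
  pw true  true  = refl
  pw true  false = refl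
  pw false b     = refl

inclusion-exclusion : ∀ {n} (p q : Sub n) →
  n + count (p ∩ q) ≡ count p + count q + count (∁ p ∩ ∁ q)
inclusion-exclusion {n} p q = arith n (count (p ∩ q)) (count (p ∩ ∁ q)) (count (∁ p ∩ q))
    (count (∁ p ∩ ∁ q)) (count p) (count (∁ p)) (count q)
    (count-not p) (count-split p q) (count-split (∁ p) q)
    (trans (count-split q p) (cong₂ _+_ (∩-comm q p) (∩-comm q (∁ p))))
  where
  ∩-comm : ∀ r s → count (r ∩ s) ≡ count (s ∩ r)
  ∩-comm r s = count-cong λ x → ∧-comm (r x) (s x)
  arith : ∀ n a b c d P P′ Q → P + P′ ≡ n → P ≡ a + b → P′ ≡ c + d → Q ≡ a + c →
          n + a ≡ P + Q + d
  arith _ a b c d _ _ _ refl refl refl refl = solve (a ∷ b ∷ c ∷ d ∷ [])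

cauchy-schwarz : ∀ {n} (f : Fin n → ℕ) → ∑ f * ∑ f ≤ n * ∑ (λ i → f i * f i)
cauchy-schwarz {n} f = *-cancelˡ-≤ 2 (begin
  2 * (∑ f * ∑ f)
    ≡⟨ cong (2 *_) (sym (trans (∑-cong λ i → ∑-* (f i) f) (∑-*ʳ (∑ f) f))) ⟩
  2 * ∑ (λ i → ∑ λ j → f i * f j)
    ≡⟨ sym (trans (∑-cong λ i → ∑-* 2 (λ j → f i * f j)) (∑-* 2 (λ i → ∑ λ j → f i * f j))) ⟩
  ∑ (λ i → ∑ λ j → 2 * (f i * f j))
    ≤⟨ ∑∑-mono (λ i j → 2xy≤x²+y² (f i) (f j)) ⟩
  ∑ (λ i → ∑ λ j → f i * f i + f j * f j)
    ≡⟨ ∑∑-+ (λ i j → f i * f i) (λ i j → f j * f j) ⟩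
  ∑ (λ i → ∑ {n} λ j → f i * f i) + ∑ {n} (λ i → ∑ λ j → f j * f j)
    ≡⟨ cong₂ _+_ (trans (∑-cong λ i → ∑-const n (f i * f i)) (∑-* n (λ i → f i * f i)))
                 (∑-const n (∑ λ j → f j * f j)) ⟩
  n * ∑ (λ i → f i * f i) + n * ∑ (λ i → f i * f i)
    ≡⟨ cong (n * ∑ (λ i → f i * f i) +_) (sym (+-identityʳ _)) ⟩
  2 * (n * ∑ (λ i → f i * f i)) ∎)
  where open ≤-Reasoning

-- Mantel's argument with links

module _ {n : ℕ} (G : Graph n) (fas : Fascinating G) where
  open Fascinating fas

  N : Fin n → Sub n
  N = adj G

  link-edges : ∀ v → e G (N v) (N v) + 12 ≡ 6 * deg G v
  link-edges v = triangulation-edges G (proj₂ (proj₁ (fd v)))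

  link-edges-≤ : ∀ v → e G (N v) (N v) ≤ 6 * deg G v
  link-edges-≤ v = ≤-trans (m≤m+n _ 12) (≤-reflexive (link-edges v))

  link-triangle : ∀ u w y → N u w ≡ true → N w y ≡ true → N u y ≡ true →
                  count (λ x → N u x ∧ N w x ∧ N y x) ≡ 2
  link-triangle u w y a b c = proj₁ (fc u w y a b c)

  private
    over-edges : (Fin n → Fin n → ℕ) → ℕ
    over-edges h = ∑ λ u → ∑ λ w → 𝟙 (N u w) * h u w

    over-edges-+ : ∀ f g → over-edges (λ u w → f u w + g u w) ≡ over-edges f + over-edges g
    over-edges-+ f g = trans (∑∑-cong λ u w → *-distribˡ-+ (𝟙 (N u w)) (f u w) (g u w))
      (∑∑-+ (λ u w → 𝟙 (N u w) * f u w) (λ u w → 𝟙 (N u w) * g u w))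

    over-edges-const : ∀ k → over-edges (λ _ _ → k) ≡ ∑ (deg G) * k
    over-edges-const k = trans (∑-cong λ u → ∑-*ʳ k (λ w → 𝟙 (N u w))) (∑-*ʳ k (deg G))

    deg² : ℕ
    deg² = ∑ λ u → deg G u * deg G u

    over-edges-tail : over-edges (λ u w → deg G u) ≡ deg²
    over-edges-tail = ∑-cong λ u → ∑-*ʳ (deg G u) (λ w → 𝟙 (N u w))

    over-edges-head : over-edges (λ u w → deg G w) ≡ deg²
    over-edges-head = trans (∑-swap (λ u w → 𝟙 (N u w) * deg G w))
      (trans (∑∑-cong λ w u → cong (λ b → 𝟙 b * deg G w) (adj-sym G u w)) over-edges-tail)

    common missed : Fin n → Fin n → ℕ
    common u w = count (N u ∩ N w)
    missed u w = count (∁ (N u) ∩ ∁ (N w))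

    -- The degree of `w` inside the link of `u` is the number of common neighbours of `u` and `w`,
    -- so this is `link-edges` summed over `u`.
    over-edges-common : over-edges common + 12 * n ≡ 6 * ∑ (deg G)
    over-edges-common = begin
      over-edges common + 12 * n
        ≡⟨ cong₂ _+_ (∑-cong λ u → sym (e-rows G (N u) (N u)))
                     (trans (*-comm 12 n) (sym (∑-const n 12))) ⟩
      ∑ (λ u → e G (N u) (N u)) + ∑ {n} (λ _ → 12)
        ≡⟨ sym (∑-+ (λ u → e G (N u) (N u)) (λ _ → 12)) ⟩
      ∑ (λ u → e G (N u) (N u) + 12)
        ≡⟨ trans (∑-cong link-edges) (∑-* 6 (deg G)) ⟩
      6 * ∑ (deg G) ∎
      where open ≡-Reasoning

    over-edges-missed : ∑ (deg G) * n + over-edges common ≡ 2 * deg² + over-edges missed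
    over-edges-missed = begin
      ∑ (deg G) * n + over-edges common
        ≡⟨ cong (_+ over-edges common) (sym (over-edges-const n)) ⟩
      over-edges (λ _ _ → n) + over-edges common
        ≡⟨ sym (over-edges-+ (λ _ _ → n) common) ⟩
      over-edges (λ u w → n + common u w)
        ≡⟨ ∑∑-cong (λ u w → cong (𝟙 (N u w) *_) (inclusion-exclusion (N u) (N w))) ⟩
      over-edges (λ u w → deg G u + deg G w + missed u w)
        ≡⟨ over-edges-+ (λ u w → deg G u + deg G w) missed ⟩
      over-edges (λ u w → deg G u + deg G w) + over-edges missed
        ≡⟨ cong (_+ over-edges missed) (trans (over-edges-+ (λ u w → deg G u) (λ u w → deg G w))
             (trans (cong₂ _+_ over-edges-tail over-edges-head) (cong (deg² +_) (sym (+-identityʳ deg²))))) ⟩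
      2 * deg² + over-edges missed ∎
      where open ≡-Reasoning

  -- Averaging: Mantel's argument, with the common neighbours of adjacent vertices controlled by link-edges.
  dominating-edge : n * n + 2 * n + 17 < 2 * ∑ (deg G) →
    ∃[ u ] ∃[ w ] (N u w ≡ true × count (∁ (N u) ∩ ∁ (N w)) ≤ 3)
  dominating-edge dense =
    let u , p = ∑-<⇒∃ (λ u → ∑ λ w → 𝟙 (N u w) * missed u w) (λ u → ∑ λ w → 𝟙 (N u w) * 4)
                      (<-≤-trans (≰⇒> few) (≤-reflexive (sym (over-edges-const 4))))
        w , q = ∑-<⇒∃ (λ w → 𝟙 (N u w) * missed u w) (λ w → 𝟙 (N u w) * 4) p
        a , m = split (N u w) q
    in u , w , a , m
    where
    -- Four is six, from the links, minus two, from the density. With D the degree sum and Q =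
    -- `deg²`, at least 4D missed vertices would give 2Q ≤ D(n + 2) - 12n; together with D² ≤ nQ
    -- this contradicts 2D > n² + 2n.
    few : ¬ (∑ (deg G) * 4 ≤ over-edges missed)
    few many = arith n (∑ (deg G)) deg² (over-edges missed) (over-edges common)
      dense (cauchy-schwarz (deg G)) many over-edges-missed over-edges-common
      where
      arith : ∀ n D Q X C → 1 + (n * n + 2 * n + 17) ≤ 2 * D → D * D ≤ n * Q → D * 4 ≤ X →
              D * n + C ≡ 2 * Q + X → C + 12 * n ≡ 6 * D → ⊥
      arith n D Q X C h₁ h₂ h₃ h₄ h₅ =
        absurd (161 + 18 * n + 21 * (n * n))
          (D ⊗ h₁ ⊕ 2 ⊗ h₂ ⊕ n ⊗ h₃ ⊕ 9 ⊗ h₁ ⊕ n ⊗ ≤-reflexive (sym h₄) ⊕ n ⊗ ≤-reflexive h₅)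
          (solve (n ∷ D ∷ Q ∷ X ∷ C ∷ []))
    split : ∀ a {k} → 𝟙 a * k < 𝟙 a * 4 → a ≡ true × k ≤ 3
    split true {k} h = refl , ≤-pred (subst (_< 4) (+-identityʳ k) h)

-- Boolean equality, written so that it computes as soon as the first argument is known: the part
-- containing `v` then reduces to `S` or to `∁ S`.
agree : Bool → Bool → Bool
agree a b = if a then b else not b

agree-sym : ∀ a b → agree a b ≡ agree b a
agree-sym true  true  = refl
agree-sym true  false = refl
agree-sym false true  = refl
agree-sym false false = refl

count-∩-comm : ∀ {n} (p q : Sub n) → count (p ∩ q) ≡ count (q ∩ p)
count-∩-comm p q = count-cong λ x → ∧-comm (p x) (q x)

-- Partitions S ⊔ ∁ S of the vertex set

module _ {n : ℕ} (G : Graph n) where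

  side : Sub n → Fin n → Sub n
  side S x y = agree (S x) (S y)

  -- A vertex lies on its own side, so it never counts itself in `miss`; `inner` does not count it
  -- either, since it is not its own neighbour.
  inner cross miss : Sub n → Fin n → ℕ
  inner S v = count (adj G v ∩ side S v)
  cross S v = count (adj G v ∩ ∁ (side S v))
  miss  S v = count (∁ (adj G v) ∩ ∁ (side S v))

  opposite : Sub n → Fin n → ℕ
  opposite S v = count (∁ (side S v))

  deg≡inner+cross : ∀ S v → deg G v ≡ inner S v + cross S v
  deg≡inner+cross S v = count-split (adj G v) (side S v)

  opposite≡cross+miss : ∀ S v → opposite S v ≡ cross S v + miss S v
  opposite≡cross+miss S v = trans (count-split (∁ (side S v)) (adj G v))
    (cong₂ _+_ (count-∩-comm (∁ (side S v)) (adj G v)) (count-∩-comm (∁ (side S v)) (∁ (adj G v))))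

  ∑-opposite : ∀ S → ∑ (opposite S) ≡ 2 * (count S * count (∁ S))
  ∑-opposite S = begin
    ∑ (opposite S)
      ≡⟨ ∑-cong pw ⟩
    ∑ (λ v → 𝟙 (S v) * count (∁ S) + 𝟙 (not (S v)) * count S)
      ≡⟨ ∑-+ (λ v → 𝟙 (S v) * count (∁ S)) (λ v → 𝟙 (not (S v)) * count S) ⟩
    ∑ (λ v → 𝟙 (S v) * count (∁ S)) + ∑ (λ v → 𝟙 (not (S v)) * count S)
      ≡⟨ cong₂ _+_ (∑-*ʳ (count (∁ S)) (𝟙 ∘ S)) (∑-*ʳ (count S) (𝟙 ∘ ∁ S)) ⟩
    count S * count (∁ S) + count (∁ S) * count S
      ≡⟨ double (count S) (count (∁ S)) ⟩
    2 * (count S * count (∁ S)) ∎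
    where
    open ≡-Reasoning
    double : ∀ a b → a * b + b * a ≡ 2 * (a * b)
    double a b = solve (a ∷ b ∷ [])
    pw : ∀ v → opposite S v ≡ 𝟙 (S v) * count (∁ S) + 𝟙 (not (S v)) * count S
    pw v with S v
    ... | true  = sym (trans (+-identityʳ _) (+-identityʳ _))
    ... | false = trans (count-cong (not-involutive ∘ S)) (sym (+-identityʳ _))

  ∑-inner : ∀ S → ∑ (inner S) ≡ e G S S + e G (∁ S) (∁ S)
  ∑-inner S = trans (∑∑-cong λ x y → pw (S x) (S y) (adj G x y))
    (∑∑-+ (λ x y → 𝟙 (S x ∧ S y ∧ adj G x y)) (λ x y → 𝟙 (∁ S x ∧ ∁ S y ∧ adj G x y)))
    where
    pw : ∀ a b c → 𝟙 (c ∧ agree a b) ≡ 𝟙 (a ∧ b ∧ c) + 𝟙 (not a ∧ not b ∧ c)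
    pw true  true  true  = refl
    pw true  true  false = refl
    pw true  false true  = refl
    pw true  false false = refl
    pw false true  true  = refl
    pw false true  false = refl
    pw false false true  = refl
    pw false false false = refl

  move : Sub n → Fin n → Sub n
  move S v y = if v == y then not (S y) else S y

  -- Only pairs containing `v` change status, and they fill one row and one column, hence the
  -- factors 2. The pair of `v` with itself lies in both, but is no edge.
  inner-move : ∀ S v → ∑ (inner (move S v)) + 2 * inner S v ≡ ∑ (inner S) + 2 * cross S v
  inner-move S v = begin
    ∑ (inner (move S v)) + 2 * inner S v
      ≡⟨ cong (∑ (inner (move S v)) +_) (cong₂ _+_ (sym (row f)) (cong (_+ 0) (sym (column f f-sym)))) ⟩
    ∑∑ f′ + (∑∑ (λ x y → 𝟙 (v == x) * f x y) + (∑∑ (λ x y → 𝟙 (v == y) * f x y) + 0))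
      ≡⟨ sym (distribute f′ f) ⟩
    ∑∑ (λ x y → f′ x y + (𝟙 (v == x) * f x y + 𝟙 (v == y) * f x y))
      ≡⟨ ∑∑-cong pw ⟩
    ∑∑ (λ x y → f x y + (𝟙 (v == x) * g x y + 𝟙 (v == y) * g x y))
      ≡⟨ distribute f g ⟩
    ∑∑ f + (∑∑ (λ x y → 𝟙 (v == x) * g x y) + (∑∑ (λ x y → 𝟙 (v == y) * g x y) + 0))
      ≡⟨ cong (∑ (inner S) +_) (cong₂ _+_ (row g) (cong (_+ 0) (column g g-sym))) ⟩
    ∑ (inner S) + 2 * cross S v ∎
    where
    open ≡-Reasoning
    ∑∑ : (Fin n → Fin n → ℕ) → ℕ
    ∑∑ h = ∑ λ x → ∑ (h x)
    f f′ g : Fin n → Fin n → ℕ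
    f  x y = 𝟙 (adj G x y ∧ agree (S x) (S y))
    f′ x y = 𝟙 (adj G x y ∧ agree (move S v x) (move S v y))
    g  x y = 𝟙 (adj G x y ∧ not (agree (S x) (S y)))
    f-sym : ∀ x y → f x y ≡ f y x
    f-sym x y = cong₂ (λ a b → 𝟙 (a ∧ b)) (adj-sym G x y) (agree-sym (S x) (S y))
    g-sym : ∀ x y → g x y ≡ g y x
    g-sym x y = cong₂ (λ a b → 𝟙 (a ∧ not b)) (adj-sym G x y) (agree-sym (S x) (S y))
    row : ∀ (h : Fin n → Fin n → ℕ) → ∑∑ (λ x y → 𝟙 (v == x) * h x y) ≡ ∑ (h v)
    row h = trans (∑-cong λ x → ∑-* (𝟙 (v == x)) (h x)) (∑-δ v (λ x → ∑ (h x)))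
    column : ∀ (h : Fin n → Fin n → ℕ) → (∀ x y → h x y ≡ h y x) → ∑∑ (λ x y → 𝟙 (v == y) * h x y) ≡ ∑ (h v)
    column h h-sym = ∑-cong λ x → trans (∑-δ v (h x)) (h-sym x v)
    distribute : ∀ (h k : Fin n → Fin n → ℕ) → ∑∑ (λ x y → h x y + (𝟙 (v == x) * k x y + 𝟙 (v == y) * k x y)) ≡
      ∑∑ h + (∑∑ (λ x y → 𝟙 (v == x) * k x y) + (∑∑ (λ x y → 𝟙 (v == y) * k x y) + 0))
    distribute h k = trans (∑∑-+ h (λ x y → 𝟙 (v == x) * k x y + 𝟙 (v == y) * k x y))
      (cong (∑∑ h +_) (trans (∑∑-+ (λ x y → 𝟙 (v == x) * k x y) (λ x y → 𝟙 (v == y) * k x y))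
        (cong (∑∑ (λ x y → 𝟙 (v == x) * k x y) +_) (sym (+-identityʳ (∑∑ (λ x y → 𝟙 (v == y) * k x y)))))))
    flip-one : ∀ p q a b c → (p ≡ true → q ≡ true → c ≡ false) →
      𝟙 (c ∧ agree (if p then not a else a) (if q then not b else b)) +
        (𝟙 p * 𝟙 (c ∧ agree a b) + 𝟙 q * 𝟙 (c ∧ agree a b)) ≡
      𝟙 (c ∧ agree a b) + (𝟙 p * 𝟙 (c ∧ not (agree a b)) + 𝟙 q * 𝟙 (c ∧ not (agree a b)))
    flip-one true  true  _     _     true  h = true≢false refl (h refl refl)
    flip-one true  true  _     _     false _ = refl
    flip-one true  false _     _     false _ = refl
    flip-one false true  _     _     false _ = refl
    flip-one false false _     _     false _ = refl
    flip-one false false _     _     true  _ = refl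
    flip-one true  false true  true  true  _ = refl
    flip-one true  false true  false true  _ = refl
    flip-one true  false false true  true  _ = refl
    flip-one true  false false false true  _ = refl
    flip-one false true  true  true  true  _ = refl
    flip-one false true  true  false true  _ = refl
    flip-one false true  false true  true  _ = refl
    flip-one false true  false false true  _ = refl
    pw : ∀ x y → f′ x y + (𝟙 (v == x) * f x y + 𝟙 (v == y) * f x y) ≡
                 f x y + (𝟙 (v == x) * g x y + 𝟙 (v == y) * g x y)
    pw x y = flip-one (v == x) (v == y) (S x) (S y) (adj G x y) λ p q →
      trans (cong (adj G x) (trans (sym (==⇒≡ v y q)) (==⇒≡ v x p))) (adj-irrefl G x)

  -- Moving a vertex with more inner than cross neighbours to the other side decreases the number of inner edges.
  local-max-cut : ∀ S → ∃[ S′ ] (∑ (inner S′) ≤ ∑ (inner S) × ∀ v → inner S′ v ≤ cross S′ v)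
  local-max-cut S = descend (∑ (inner S)) S ≤-refl
    where
    decrease : ∀ a b i c → a + 2 * i ≡ b + 2 * c → 1 + c ≤ i → 1 + a ≤ b
    decrease a b i c h₁ h₂ = lin 1 (≤-reflexive h₁ ⊕ 2 ⊗ h₂) (solve (a ∷ b ∷ i ∷ c ∷ []))
    descend : ∀ k S → ∑ (inner S) ≤ k → ∃[ S′ ] (∑ (inner S′) ≤ ∑ (inner S) × ∀ v → inner S′ v ≤ cross S′ v)
    descend k S bound with any? (λ v → cross S v <? inner S v)
    ... | no none = S , ≤-refl , λ v → ≮⇒≥ λ lt → none (v , lt)
    descend zero S bound | yes (v , lt) =
      contradiction (≤-trans (≤-trans (s≤s z≤n) (<-≤-trans lt (∑-≥ (inner S) v))) bound) λ ()
    descend (suc k) S bound | yes (v , lt) =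
      let lower = decrease (∑ (inner (move S v))) (∑ (inner S)) (inner S v) (cross S v) (inner-move S v) lt
          S′ , le , max = descend k (move S v) (≤-pred (≤-trans lower bound))
      in S′ , ≤-trans le (<⇒≤ lower) , max

-- A cut with few inner edges

module _ {n : ℕ} (G : Graph n) (fas : Fascinating G) (dense : n * n + 2 * n + 17 < 2 * ∑ (deg G)) where

  -- The initial cut is the neighbourhood of `w` against its complement, and 18 = 6 + 6 + 3 + 3: the
  -- pairs within the links of `w` and `u` give 6n each, and the at most three vertices outside both
  -- give 3n in either position of the pair.
  sparse-partition : ∃[ S ] (∑ (inner G S) ≤ 18 * n × ∀ v → inner G S v ≤ cross G S v)
  sparse-partition =
    let u , w , _ , few = dominating-edge G fas dense
        S , le , max = local-max-cut G (adj G w)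
    in S , ≤-trans le (start u w few) , max
    where
    start : ∀ u w → count (∁ (adj G u) ∩ ∁ (adj G w)) ≤ 3 → ∑ (inner G (adj G w)) ≤ 18 * n
    start u w few = arith n (deg G u) (deg G w) (∑ (inner G W)) (e G W W) (e G (∁ W) (∁ W))
        (e G (∁ W ∩ U) (∁ W ∩ U)) (e G (∁ W ∩ ∁ U) (∁ W ∩ U)) (e G (∁ W) (∁ W ∩ ∁ U))
        (∑-inner G W) (link-edges-≤ G fas w)
        (trans (e-splitʳ G (∁ W) (∁ W) U) (cong (_+ e G (∁ W) (∁ W ∩ ∁ U)) (e-splitˡ G (∁ W) (∁ W ∩ U) U)))
        (≤-trans (e-mono G (∁ W ∩ U) U (∁ W ∩ U) U (∩-⊆ʳ (∁ W) U) (∩-⊆ʳ (∁ W) U)) (link-edges-≤ G fas u))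
        (small (∁ W ∩ U)) (≤-trans (≤-reflexive (e-sym G (∁ W) (∁ W ∩ ∁ U))) (small (∁ W)))
        (count≤n U) (count≤n W)
      where
      U W : Sub n
      U = adj G u
      W = adj G w
      small : ∀ P → e G (∁ W ∩ ∁ U) P ≤ n * 3
      small P = ≤-trans (e-≤ G (∁ W ∩ ∁ U) P n (λ x _ → count≤n (P ∩ adj G x)))
        (*-monoʳ-≤ n (≤-trans (≤-reflexive (count-∩-comm (∁ W) (∁ U))) few))
      arith : ∀ n du dw I ww vv a b c → I ≡ ww + vv → ww ≤ 6 * dw → vv ≡ a + b + c → a ≤ 6 * du →
              b ≤ n * 3 → c ≤ n * 3 → du ≤ n → dw ≤ n → I ≤ 18 * n
      arith n du dw I ww vv a b c refl h₁ refl h₂ h₃ h₄ h₅ h₆ =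
        lin 0 (h₁ ⊕ h₂ ⊕ h₃ ⊕ h₄ ⊕ 6 ⊗ h₅ ⊕ 6 ⊗ h₆)
          (solve (n ∷ du ∷ dw ∷ ww ∷ a ∷ b ∷ c ∷ []))

-- Later applied to quantities i ≤ √(36 n), such as inner degrees and the imbalance of the cut.
root-bound : ∀ K i n → i * i ≤ 36 * n → 36 * (K * K) ≤ n → K * i ≤ n
root-bound K i n h large = ≮⇒≥ contradict
  where
  contradict : ¬ (1 + n ≤ K * i)
  contradict lt = absurd (2 * n) (*-mono-≤ lt lt ⊕ (K * K) ⊗ h ⊕ n ⊗ large) (solve (K ∷ i ∷ n ∷ []))

-- The hypothesis is (α - β)² ≤ 36n, so `root-bound` applies to the difference.
balance : ∀ K α β n → α * α + β * β ≤ 2 * (α * β) + 36 * n → 36 * (K * K) ≤ n → K * β ≤ K * α + n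
balance K α β n h large with ≤-total β α
... | inj₁ β≤α = ≤-trans (K ⊗ β≤α) (m≤m+n (K * α) n)
... | inj₂ α≤β with m≤n⇒∃[o]m+o≡n α≤β
...   | d , refl = lin 0 (root-bound K d n (lin 0 h (solve (α ∷ d ∷ n ∷ []))) large) (solve (K ∷ α ∷ d ∷ n ∷ []))

-- Balance, missing pairs and inner degrees of the cut

module _ {n : ℕ} (G : Graph n) (fas : Fascinating G) (dense : n * n + 2 * n + 17 < 2 * ∑ (deg G))
         (K : ℕ) (large : 36 * (K * K) ≤ n) (S : Sub n) (few : ∑ (inner G S) ≤ 18 * n)
         (max : ∀ v → inner G S v ≤ cross G S v) where

  private
    α β : ℕ
    α = count S
    β = count (∁ S)

  -- Without subtraction, this is (α - β)² + 2n + 18 + 2 Σ miss ≤ 2 Σ inner: the inner pairs have to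
  -- pay for the imbalance of the cut as well as for its missing pairs.
  inner-exceeds : α * α + β * β + 2 * n + 18 + 2 * ∑ (miss G S) ≤ 2 * ∑ (inner G S) + 2 * (α * β)
  inner-exceeds = arith n (∑ (deg G)) (∑ (inner G S)) (∑ (cross G S)) (∑ (miss G S)) (∑ (opposite G S)) α β
      dense (trans (∑-cong (deg≡inner+cross G S)) (∑-+ (inner G S) (cross G S)))
      (trans (∑-cong (opposite≡cross+miss G S)) (∑-+ (cross G S) (miss G S)))
      (∑-opposite G S) (count-not S)
    where
    arith : ∀ n D I C M O α β → 1 + (n * n + 2 * n + 17) ≤ 2 * D → D ≡ I + C → O ≡ C + M →
            O ≡ 2 * (α * β) → α + β ≡ n → α * α + β * β + 2 * n + 18 + 2 * M ≤ 2 * I + 2 * (α * β)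
    arith _ _ I C M _ α β h refl refl k refl = lin 0 (h ⊕ 2 ⊗ ≤-reflexive k) (solve (I ∷ C ∷ M ∷ α ∷ β ∷ []))

  missing≤inner : ∑ (miss G S) + n ≤ ∑ (inner G S)
  missing≤inner = *-cancelˡ-≤ 2 (arith n (∑ (inner G S)) (∑ (miss G S)) α β inner-exceeds (2xy≤x²+y² α β))
    where
    arith : ∀ n I M α β → α * α + β * β + 2 * n + 18 + 2 * M ≤ 2 * I + 2 * (α * β) →
            2 * (α * β) ≤ α * α + β * β → 2 * (M + n) ≤ 2 * I
    arith n I M α β h k = lin 18 (h ⊕ k) (solve (n ∷ I ∷ M ∷ α ∷ β ∷ []))

  missing≤ : ∑ (miss G S) ≤ 17 * n
  missing≤ = lin 0 (missing≤inner ⊕ few) (arith n (∑ (inner G S)) (∑ (miss G S)))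
    where
    arith : ∀ n I M → M + (I + 18 * n) + 0 ≡ 17 * n + (M + n + I)
    arith n I M = solve (n ∷ I ∷ M ∷ [])

  opposite-large : ∀ v → K * n ≤ 2 * (K * opposite G S v) + n
  opposite-large v = by-side (S v) refl
    where
    arith : ∀ n α β → α + β ≡ n → K * β ≤ K * α + n → K * n ≤ 2 * (K * α) + n
    arith _ α β refl h = lin 0 h (solve (K ∷ α ∷ β ∷ []))
    squares : α * α + β * β ≤ 2 * (α * β) + 36 * n
    squares = lin (18 + 2 * n + 2 * ∑ (miss G S)) (inner-exceeds ⊕ 2 ⊗ few)
        (id′ α β n (∑ (inner G S)) (∑ (miss G S)))
      where
      id′ : ∀ α β n I M → α * α + β * β + (2 * I + 2 * (α * β) + 2 * (18 * n)) + (18 + 2 * n + 2 * M) ≡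
            2 * (α * β) + 36 * n + (α * α + β * β + 2 * n + 18 + 2 * M + 2 * I)
      id′ α β n I M = solve (α ∷ β ∷ n ∷ I ∷ M ∷ [])
    by-side : ∀ b → S v ≡ b → K * n ≤ 2 * (K * opposite G S v) + n
    by-side true  Sv = subst (λ b → K * n ≤ 2 * (K * count (λ y → not (agree b (S y)))) + n) (sym Sv)
      (arith n β α (trans (+-comm β α) (count-not S)) (balance K β α n
        (subst₂ (λ x y → x ≤ 2 * y + 36 * n) (+-comm (α * α) (β * β)) (*-comm α β) squares) large))
    by-side false Sv = subst (λ b → K * n ≤ 2 * (K * count (λ y → not (agree b (S y)))) + n) (sym Sv)
      (subst (λ c → K * n ≤ 2 * (K * c) + n) (count-cong (λ y → sym (not-involutive (S y))))
        (arith n α β (count-not S) (balance K α β n squares large)))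

  -- Local maximality bounds the square of the inner degree by the number of pairs of an inner and a
  -- cross neighbour of `v`. Adjacent pairs are edges of the link, at most 6n; the others are
  -- missing pairs of the cut, at most 17n.
  inner-small : ∀ v → K * inner G S v ≤ n
  inner-small v = root-bound K (inner G S v) n (≤-trans square (*-monoˡ-≤ n (m≤m+n 23 13))) large
    where
    X Y : Sub n
    X = adj G v ∩ side G S v
    Y = adj G v ∩ ∁ (side G S v)
    separated : ē G X Y ≤ ∑ (miss G S)
    separated = ∑∑-mono λ x y → bool≤ 6 (λ vx vy xy sv sx sy →
      𝟙 ((vx ∧ agree sv sx) ∧ (vy ∧ not (agree sv sy)) ∧ not xy) , 𝟙 (not xy ∧ not (agree sx sy)))
      refl (adj G v x) (adj G v y) (adj G x y) (S v) (S x) (S y)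
    arith : ∀ n i c E Ē M L d → i * i ≤ i * c → E + Ē ≡ i * c → E ≤ L → Ē ≤ M → L ≤ 6 * d → d ≤ n → M ≤ 17 * n →
            i * i ≤ 23 * n
    arith n i c E Ē M L d h₁ h₂ h₃ h₄ h₅ h₆ h₇ =
      lin 0 (h₁ ⊕ ≤-reflexive (sym h₂) ⊕ h₃ ⊕ h₄ ⊕ h₅ ⊕ 6 ⊗ h₆ ⊕ h₇)
        (solve (n ∷ i ∷ c ∷ E ∷ Ē ∷ M ∷ L ∷ d ∷ []))
    square : inner G S v * inner G S v ≤ 23 * n
    square = arith n (inner G S v) (cross G S v) (e G X Y) (ē G X Y) (∑ (miss G S)) (e G (adj G v) (adj G v)) (deg G v)
      (*-monoʳ-≤ (inner G S v) (max v)) (e+ē G X Y)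
      (e-mono G X (adj G v) Y (adj G v) (∩-⊆ˡ (adj G v) (side G S v)) (∩-⊆ˡ (adj G v) (∁ (side G S v)))) separated
      (link-edges-≤ G fas v) (count≤n (adj G v)) missing≤

-- A vertex with three neighbours on its own side

count-3 : ∀ {n} (p : Sub n) {x y z : Fin n} → x ≢ y → x ≢ z → y ≢ z →
          𝟙 (p x) + 𝟙 (p y) + 𝟙 (p z) ≤ count p
count-3 p {x} {y} {z} x≢y x≢z y≢z = begin
  𝟙 (p x) + 𝟙 (p y) + 𝟙 (p z)
    ≡⟨ cong₂ (λ a b → 𝟙 (p x) + 𝟙 a + 𝟙 b) (sym (keep x y (p y) x≢y))
         (sym (trans (keep y z (p z ∧ not (x == z)) y≢z) (keep x z (p z) x≢z))) ⟩
  𝟙 (p x) + 𝟙 ((p ∖ x) y) + 𝟙 (((p ∖ x) ∖ y) z)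
    ≤⟨ +-monoʳ-≤ (𝟙 (p x) + 𝟙 ((p ∖ x) y)) (∑-≥ (𝟙 ∘ ((p ∖ x) ∖ y)) z) ⟩
  𝟙 (p x) + 𝟙 ((p ∖ x) y) + count ((p ∖ x) ∖ y)
    ≡⟨ +-assoc (𝟙 (p x)) _ _ ⟩
  𝟙 (p x) + (𝟙 ((p ∖ x) y) + count ((p ∖ x) ∖ y))
    ≡⟨ cong (𝟙 (p x) +_) (sym (count-∖ (p ∖ x) y)) ⟩
  𝟙 (p x) + count (p ∖ x)
    ≡⟨ sym (count-∖ p x) ⟩
  count p ∎
  where
  open ≤-Reasoning
  keep : ∀ i j b → i ≢ j → b ∧ not (i == j) ≡ b
  keep i j b i≢j rewrite ≢⇒== i≢j = ∧-identityʳ b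

module _ {n : ℕ} (G : Graph n) (fas : Fascinating G) where
  open Fascinating fas

  link-vertex : ∀ v y → adj G v y ≡ true → ∃[ z ] (adj G v z ≡ true × adj G y z ≡ true)
  link-vertex v y a with fb v y a
  ... | suc k , _ , _ , f , _ , mem , _ = f F.zero , ∧-true (Equivalence.from (mem (f F.zero)) (F.zero , refl))

  two-common : ∀ v y → adj G v y ≡ true → 2 ≤ count (adj G v ∩ adj G y)
  two-common v y a =
    let z , vz , yz = link-vertex v y a in
    ≤-trans (≤-reflexive (sym (link-triangle G fas v y z a yz vz)))
      (count-mono λ x h → let vx , h′ = ∧-true {adj G v x} h in ∧-intro vx (proj₁ (∧-true h′)))

  -- Counts the 4-cliques v w x y with x in X and y in Y.
  clique-bound : ∀ v w X Y → adj G v w ≡ true → (∀ x → X x ≡ true → adj G v x ≡ true) →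
                 (∀ x → Y x ≡ true → adj G v x ≡ true) →
                 e G (X ∩ adj G w) (Y ∩ adj G w) ≤ 2 * count (X ∩ adj G w)
  clique-bound v w X Y vw X⊆ Y⊆ = e-≤ G (X ∩ adj G w) (Y ∩ adj G w) 2 λ x h →
    let Xx , wx = ∧-true {X x} h in
    ≤-trans (count-mono λ y k → let k′ , xy = ∧-true {(Y ∩ adj G w) y} k ; Yy , wy = ∧-true {Y y} k′ in
                                 ∧-intro (Y⊆ y Yy) (∧-intro wy xy))
            (≤-reflexive (link-triangle G fas v w x vw wx (X⊆ x Xx)))

  -- Three neighbours w₁, w₂, w₃ of v inside P: a vertex y of N v outside P that is adjacent to all of them
  -- would contribute 8 to the sum of 2 |N y ∩ P| + |N y ∖ P| over the link of v, whose average is only about 6.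
  module _ (P : Sub n) (v : Fin n) where

    private
      X Y : Sub n
      X = adj G v ∩ P
      Y = adj G v ∩ ∁ P

      X⊆ : ∀ x → X x ≡ true → adj G v x ≡ true
      X⊆ = ∩-⊆ˡ (adj G v) P

      Y⊆ : ∀ x → Y x ≡ true → adj G v x ≡ true
      Y⊆ = ∩-⊆ˡ (adj G v) (∁ P)

      a b : Fin n → ℕ
      a y = count (X ∩ adj G y)
      b y = count (Y ∩ adj G y)

      k : Fin n → Fin n → ℕ
      k w y = count ((X ∩ adj G w) ∩ adj G y)

      a+b : ∀ y → Y y ≡ true → 2 ≤ 2 * a y + b y
      a+b y Yy = ≤-trans (two-common v y (Y⊆ y Yy)) (≤-trans (≤-reflexive (trans (count-split (adj G v ∩ adj G y) P)
          (cong₂ _+_ (count-cong λ x → regroup (adj G v x) (adj G y x) (P x))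
                     (count-cong λ x → regroup (adj G v x) (adj G y x) (not (P x))))))
        (+-monoˡ-≤ (b y) (m≤m+n (a y) _)))
        where
        regroup : ∀ p q r → (p ∧ q) ∧ r ≡ (p ∧ r) ∧ q
        regroup true  q r = ∧-comm q r
        regroup false q r = refl

      b+k : ∀ w y → X w ≡ true → Y y ≡ true → adj G w y ≡ true → 2 ≤ b y + k w y
      b+k w y Xw Yy wy = begin
        2
          ≡⟨ sym (link-triangle G fas v w y (X⊆ w Xw) wy (Y⊆ y Yy)) ⟩
        count L
          ≡⟨ count-split L (∁ P) ⟩
        count (L ∩ ∁ P) + count (L ∩ ∁ (∁ P))
          ≤⟨ +-mono-≤
               (∑-mono λ x → bool≤ 4 (λ vx wx yx px → 𝟙 ((vx ∧ wx ∧ yx) ∧ not px) , 𝟙 ((vx ∧ not px) ∧ yx)) refl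
                 (adj G v x) (adj G w x) (adj G y x) (P x))
               (∑-mono λ x → bool≤ 4 (λ vx wx yx px → 𝟙 ((vx ∧ wx ∧ yx) ∧ not (not px)) ,
                                                      𝟙 (((vx ∧ px) ∧ wx) ∧ yx)) refl
                 (adj G v x) (adj G w x) (adj G y x) (P x)) ⟩
        b y + k w y ∎
        where
        open ≤-Reasoning
        L : Sub n
        L x = adj G v x ∧ adj G w x ∧ adj G y x

      -- What `w` adds to the weight of `y`: two units as compensation if `w` and `y` are not
      -- adjacent, otherwise the number of 4-cliques on `v`, `w`, `y` with fourth vertex in `X`.
      term : Fin n → Fin n → ℕ
      term w y = 2 * 𝟙 (Y y ∧ not (adj G w y)) + 𝟙 (Y y ∧ adj G w y) * k w y

      ∑-term : ∀ w → X w ≡ true → ∑ (term w) ≤ 2 * count (∁ (adj G w) ∩ ∁ P) + 2 * count X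
      ∑-term w Xw = begin
        ∑ (term w)
          ≡⟨ ∑-+ (λ y → 2 * 𝟙 (Y y ∧ not (adj G w y))) (λ y → 𝟙 (Y y ∧ adj G w y) * k w y) ⟩
        ∑ (λ y → 2 * 𝟙 (Y y ∧ not (adj G w y))) + ∑ (λ y → 𝟙 (Y y ∧ adj G w y) * k w y)
          ≡⟨ cong₂ _+_ (∑-* 2 (λ y → 𝟙 (Y y ∧ not (adj G w y))))
               (trans (sym (e-rows G (Y ∩ adj G w) (X ∩ adj G w))) (e-sym G (Y ∩ adj G w) (X ∩ adj G w))) ⟩
        2 * count (Y ∩ ∁ (adj G w)) + e G (X ∩ adj G w) (Y ∩ adj G w)
          ≤⟨ +-mono-≤ (2 ⊗ ∑-mono λ y → bool≤ 3 (λ vy py wy → 𝟙 ((vy ∧ not py) ∧ not wy) , 𝟙 (not wy ∧ not py)) refl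
                                           (adj G v y) (P y) (adj G w y))
               (≤-trans (clique-bound v w X Y (X⊆ w Xw) X⊆ Y⊆) (2 ⊗ count-mono (∩-⊆ˡ X (adj G w)))) ⟩
        2 * count (∁ (adj G w) ∩ ∁ P) + 2 * count X ∎
        where open ≤-Reasoning

      -- Six units come from the three vertices: an adjacent one adds 2 to `2 * a y`, any other one
      -- has 2 in its `term`. Two more come from the vertices completing a triangle `v wᵢ y`, which
      -- lie in `Y` and count in `b y`, or in `X` and count in `k wᵢ y`. If `y` is adjacent to none
      -- of the three, `two-common` supplies them.
      weight : ∀ {w₁ w₂ w₃} → X w₁ ≡ true → X w₂ ≡ true → X w₃ ≡ true →
               w₁ ≢ w₂ → w₁ ≢ w₃ → w₂ ≢ w₃ → ∀ y →
               𝟙 (Y y) * 8 ≤ 2 * (𝟙 (Y y) * a y) + 𝟙 (Y y) * b y + (term w₁ y + (term w₂ y + term w₃ y))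
      weight {w₁} {w₂} {w₃} X₁ X₂ X₃ n₁₂ n₁₃ n₂₃ y =
        cases (Y y) (adj G w₁ y) (adj G w₂ y) (adj G w₃ y)
          (λ _ → lower) (a+b y) (b+k w₁ y X₁) (b+k w₂ y X₂) (b+k w₃ y X₃)
        where
        at : ∀ w → X w ≡ true → (X ∩ adj G y) w ≡ adj G w y
        at w Xw = trans (cong (_∧ adj G y w) Xw) (adj-sym G y w)
        lower : 𝟙 (adj G w₁ y) + 𝟙 (adj G w₂ y) + 𝟙 (adj G w₃ y) ≤ a y
        lower = subst₂ (λ p q → 𝟙 p + 𝟙 q + 𝟙 (adj G w₃ y) ≤ a y) (at w₁ X₁) (at w₂ X₂)
          (subst (λ r → 𝟙 ((X ∩ adj G y) w₁) + 𝟙 ((X ∩ adj G y) w₂) + 𝟙 r ≤ a y) (at w₃ X₃)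
            (count-3 (X ∩ adj G y) n₁₂ n₁₃ n₂₃))
        some : ∀ {a₁ a₂ a₃ b₁ b₂ b₃} r₁ r₂ r₃ α β → a₁ + b₁ ≡ 1 → a₂ + b₂ ≡ 1 → a₃ + b₃ ≡ 1 →
               a₁ + a₂ + a₃ ≤ α → 2 ≤ β + (r₁ + r₂ + r₃) →
               8 ≤ 2 * (α + 0) + (β + 0) + (2 * b₁ + r₁ + (2 * b₂ + r₂ + (2 * b₃ + r₃)))
        some {a₁} {a₂} {a₃} {b₁} {b₂} {b₃} r₁ r₂ r₃ α β h₁ h₂ h₃ h h′ = lin 0
          (2 ⊗ ≤-reflexive (sym h₁) ⊕ 2 ⊗ ≤-reflexive (sym h₂) ⊕ 2 ⊗ ≤-reflexive (sym h₃) ⊕ 2 ⊗ h ⊕ h′)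
          (solve (a₁ ∷ a₂ ∷ a₃ ∷ b₁ ∷ b₂ ∷ b₃ ∷ r₁ ∷ r₂ ∷ r₃ ∷ α ∷ β ∷ []))
        none : ∀ α β → 2 ≤ 2 * α + β → 8 ≤ 2 * (α + 0) + (β + 0) + (2 * 1 + 0 + (2 * 1 + 0 + (2 * 1 + 0)))
        none α β h = lin 0 h (solve (α ∷ β ∷ []))
        complement : ∀ c → 𝟙 c + 𝟙 (not c) ≡ 1
        complement true  = refl
        complement false = refl
        cases : ∀ Yy c₁ c₂ c₃ {k₁ k₂ k₃ α β} → (Yy ≡ true → 𝟙 c₁ + 𝟙 c₂ + 𝟙 c₃ ≤ α) → (Yy ≡ true → 2 ≤ 2 * α + β) →
          (Yy ≡ true → c₁ ≡ true → 2 ≤ β + k₁) → (Yy ≡ true → c₂ ≡ true → 2 ≤ β + k₂) →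
          (Yy ≡ true → c₃ ≡ true → 2 ≤ β + k₃) →
          𝟙 Yy * 8 ≤ 2 * (𝟙 Yy * α) + 𝟙 Yy * β + (2 * 𝟙 (Yy ∧ not c₁) + 𝟙 (Yy ∧ c₁) * k₁ +
            (2 * 𝟙 (Yy ∧ not c₂) + 𝟙 (Yy ∧ c₂) * k₂ + (2 * 𝟙 (Yy ∧ not c₃) + 𝟙 (Yy ∧ c₃) * k₃)))
        cases false _ _ _ _ _ _ _ _ = z≤n
        cases true false false false {α = α} {β} _ h _ _ _ = none α β (h refl)
        cases true true c₂ c₃ {k₁} {k₂} {k₃} {α} {β} h _ h₁ _ _ =
          some {1} {𝟙 c₂} {𝟙 c₃} {0} {𝟙 (not c₂)} {𝟙 (not c₃)} (1 * k₁) (𝟙 c₂ * k₂) (𝟙 c₃ * k₃) α β refl (complement c₂) (complement c₃) (h refl)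
            (≤-trans (h₁ refl refl) (+-monoʳ-≤ β (≤-trans (m≤m+n k₁ 0) (≤-trans (m≤m+n (k₁ + 0) _) (m≤m+n _ _)))))
        cases true false true c₃ {k₁} {k₂} {k₃} {α} {β} h _ _ h₂ _ =
          some {0} {1} {𝟙 c₃} {1} {0} {𝟙 (not c₃)} 0 (1 * k₂) (𝟙 c₃ * k₃) α β refl refl (complement c₃) (h refl)
            (≤-trans (h₂ refl refl) (+-monoʳ-≤ β (≤-trans (m≤m+n k₂ 0) (m≤m+n (k₂ + 0) _))))
        cases true false false true {k₁} {k₂} {k₃} {α} {β} h _ _ _ h₃ =
          some {0} {0} {1} {1} {1} {0} 0 0 (1 * k₃) α β refl refl refl (h refl)
            (≤-trans (h₃ refl refl) (+-monoʳ-≤ β (m≤m+n k₃ 0)))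

    three-inner : (ws : Three X) → let open Three ws in
      count Y ≤ count (∁ (adj G w₁) ∩ ∁ P) + count (∁ (adj G w₂) ∩ ∁ P) + count (∁ (adj G w₃) ∩ ∁ P) + 6 * count X
    three-inner (three {w₁} {w₂} {w₃} X₁ X₂ X₃ n₁₂ n₁₃ n₂₃) =
      arith (count X) (count Y) (e G X X) (e G X Y) (e G Y Y) (e G (adj G v) (adj G v)) (deg G v)
        (∑ (term w₁)) (∑ (term w₂)) (∑ (term w₃))
        (count (∁ (adj G w₁) ∩ ∁ P)) (count (∁ (adj G w₂) ∩ ∁ P)) (count (∁ (adj G w₃) ∩ ∁ P))
        (count-split (adj G v) P) (e-split G (adj G v) P) (link-edges-≤ G fas v) total
        (∑-term w₁ X₁) (∑-term w₂ X₂) (∑-term w₃ X₃)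
      where
      total : count Y * 8 ≤ 2 * e G X Y + e G Y Y + (∑ (term w₁) + (∑ (term w₂) + ∑ (term w₃)))
      total = begin
        count Y * 8
          ≡⟨ sym (∑-*ʳ 8 (𝟙 ∘ Y)) ⟩
        ∑ (λ y → 𝟙 (Y y) * 8)
          ≤⟨ ∑-mono (weight X₁ X₂ X₃ n₁₂ n₁₃ n₂₃) ⟩
        ∑ (λ y → 2 * (𝟙 (Y y) * a y) + 𝟙 (Y y) * b y + (term w₁ y + (term w₂ y + term w₃ y)))
          ≡⟨ ∑-+ (λ y → 2 * (𝟙 (Y y) * a y) + 𝟙 (Y y) * b y) (λ y → term w₁ y + (term w₂ y + term w₃ y)) ⟩
        ∑ (λ y → 2 * (𝟙 (Y y) * a y) + 𝟙 (Y y) * b y) + ∑ (λ y → term w₁ y + (term w₂ y + term w₃ y))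
          ≡⟨ cong₂ _+_ (∑-+ (λ y → 2 * (𝟙 (Y y) * a y)) (λ y → 𝟙 (Y y) * b y))
               (trans (∑-+ (term w₁) (λ y → term w₂ y + term w₃ y)) (cong (∑ (term w₁) +_) (∑-+ (term w₂) (term w₃)))) ⟩
        ∑ (λ y → 2 * (𝟙 (Y y) * a y)) + ∑ (λ y → 𝟙 (Y y) * b y) + (∑ (term w₁) + (∑ (term w₂) + ∑ (term w₃)))
          ≡⟨ cong (_+ (∑ (term w₁) + (∑ (term w₂) + ∑ (term w₃)))) (cong₂ _+_
               (trans (∑-* 2 (λ y → 𝟙 (Y y) * a y)) (cong (2 *_) (trans (sym (e-rows G Y X)) (e-sym G Y X))))
               (sym (e-rows G Y Y))) ⟩
        2 * e G X Y + e G Y Y + (∑ (term w₁) + (∑ (term w₂) + ∑ (term w₃))) ∎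
        where open ≤-Reasoning
      -- Eight units per vertex of `Y` against six from the link leave 2y ≤ 6x + t₁ + t₂ + t₃, and
      -- each `tᵢ` brings another 2x; halved, this is the coefficient 6.
      arith : ∀ x y XX XY YY L d t₁ t₂ t₃ m₁ m₂ m₃ → d ≡ x + y → L ≡ XX + 2 * XY + YY → L ≤ 6 * d →
              y * 8 ≤ 2 * XY + YY + (t₁ + (t₂ + t₃)) →
              t₁ ≤ 2 * m₁ + 2 * x → t₂ ≤ 2 * m₂ + 2 * x → t₃ ≤ 2 * m₃ + 2 * x →
              y ≤ m₁ + m₂ + m₃ + 6 * x
      arith x y XX XY YY _ _ t₁ t₂ t₃ m₁ m₂ m₃ refl refl h k k₁ k₂ k₃ = *-cancelˡ-≤ 2
        (lin XX (h ⊕ k ⊕ k₁ ⊕ k₂ ⊕ k₃)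
          (solve (x ∷ y ∷ XX ∷ XY ∷ YY ∷ t₁ ∷ t₂ ∷ t₃ ∷ m₁ ∷ m₂ ∷ m₃ ∷ [])))

-- A few rows of a symmetric relation

multiplicity : ∀ {n} → List (Fin n) → Fin n → ℕ
multiplicity []       y = 0
multiplicity (t ∷ ts) y = 𝟙 (t == y) + multiplicity ts y

multiplicity-∉ : ∀ {n} {y : Fin n} {ts} → All.All (y ≢_) ts → multiplicity ts y ≡ 0
multiplicity-∉ All.[]                       = refl
multiplicity-∉ (ne All.∷ nes) rewrite ≢⇒== (ne ∘ sym) = multiplicity-∉ nes

multiplicity≤1 : ∀ {n} {ts : List (Fin n)} → Unique ts → ∀ y → multiplicity ts y ≤ 1
multiplicity≤1 AllPairs.[] y = z≤n
multiplicity≤1 {ts = t ∷ ts} (ne AllPairs.∷ u) y with t ≟ y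
... | no _     = multiplicity≤1 u y
... | yes refl = s≤s (≤-reflexive (multiplicity-∉ ne))

∑-multiplicity : ∀ {n} (ts : List (Fin n)) (f : Fin n → ℕ) →
                 ∑ (λ y → multiplicity ts y * f y) ≡ sum (map f ts)
∑-multiplicity {n} [] f = ∑-0 n
∑-multiplicity (t ∷ ts) f = trans (∑-cong λ y → *-distribʳ-+ (f y) (𝟙 (t == y)) (multiplicity ts y))
  (trans (∑-+ (λ y → 𝟙 (t == y) * f y) (λ y → multiplicity ts y * f y)) (cong₂ _+_ (∑-δ t f) (∑-multiplicity ts f)))

-- The rows and the columns indexed by `ts` overlap only where both indices lie in `ts`, which costs
-- at most the square of its length.
∑∑-rows : ∀ {n} {ts : List (Fin n)} → Unique ts → (h : Fin n → Fin n → Bool) → (∀ x y → h x y ≡ h y x) →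
          2 * sum (map (count ∘ h) ts) ≤ ∑ (λ x → count (h x)) + length ts * length ts
∑∑-rows {n} {ts} u h h-sym = begin
  2 * sum (map (count ∘ h) ts)
    ≡⟨ cong₂ _+_ (sym rows) (trans (+-identityʳ _) (sym columns)) ⟩
  ∑∑ (λ x y → z x * 𝟙 (h x y)) + ∑∑ (λ x y → z y * 𝟙 (h x y))
    ≡⟨ sym (∑∑-+ (λ x y → z x * 𝟙 (h x y)) (λ x y → z y * 𝟙 (h x y))) ⟩
  ∑∑ (λ x y → z x * 𝟙 (h x y) + z y * 𝟙 (h x y))
    ≤⟨ ∑∑-mono (λ x y → pw (multiplicity≤1 u x) (multiplicity≤1 u y) (h x y)) ⟩
  ∑∑ (λ x y → 𝟙 (h x y) + z x * z y)
    ≡⟨ ∑∑-+ (λ x y → 𝟙 (h x y)) (λ x y → z x * z y) ⟩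
  ∑ (λ x → count (h x)) + ∑∑ (λ x y → z x * z y)
    ≡⟨ cong (∑ (λ x → count (h x)) +_) (trans (∑-cong λ x → ∑-* (z x) z) (trans (∑-*ʳ (∑ z) z) (cong₂ _*_ total total))) ⟩
  ∑ (λ x → count (h x)) + length ts * length ts ∎
  where
  open ≤-Reasoning
  ∑∑ : (Fin n → Fin n → ℕ) → ℕ
  ∑∑ f = ∑ λ x → ∑ (f x)
  z : Fin n → ℕ
  z = multiplicity ts
  rows : ∑∑ (λ x y → z x * 𝟙 (h x y)) ≡ sum (map (count ∘ h) ts)
  rows = trans (∑-cong λ x → ∑-* (z x) (𝟙 ∘ h x)) (∑-multiplicity ts (count ∘ h))
  columns : ∑∑ (λ x y → z y * 𝟙 (h x y)) ≡ sum (map (count ∘ h) ts)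
  columns = trans (∑-swap (λ x y → z y * 𝟙 (h x y)))
    (trans (∑∑-cong λ y x → cong (λ b → z y * 𝟙 b) (h-sym x y)) rows)
  total : ∑ z ≡ length ts
  total = trans (∑-cong λ x → sym (*-identityʳ (z x))) (trans (∑-multiplicity ts (λ _ → 1)) (ones ts))
    where
    ones : (l : List (Fin n)) → sum (map (λ _ → 1) l) ≡ length l
    ones []      = refl
    ones (_ ∷ l) = cong suc (ones l)
  pw : ∀ {a b} → a ≤ 1 → b ≤ 1 → ∀ c → a * 𝟙 c + b * 𝟙 c ≤ 𝟙 c + a * b
  pw {a} {b} _         _         false rewrite *-zeroʳ a | *-zeroʳ b = z≤n
  pw {0} {0} _         _         true = z≤n
  pw {0} {1} _         _         true = ≤-refl
  pw {1} {0} _         _         true = ≤-refl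
  pw {1} {1} _         _         true = ≤-refl
  pw {suc (suc _)} (s≤s ()) _ true
  pw {0} {suc (suc _)} _ (s≤s ()) true
  pw {1} {suc (suc _)} _ (s≤s ()) true

-- Typical vertices and inner degrees at most two

agree⇒≡ : ∀ a b → agree a b ≡ true → a ≡ b
agree⇒≡ true  true  _ = refl
agree⇒≡ false false _ = refl

three-map : ∀ {n} {p q : Sub n} → (∀ x → p x ≡ true → q x ≡ true) → Three p → Three q
three-map f (three {w₁} {w₂} {w₃} p₁ p₂ p₃ n₁₂ n₁₃ n₂₃) = three (f w₁ p₁) (f w₂ p₂) (f w₃ p₃) n₁₂ n₁₃ n₂₃

module _ {n : ℕ} (G : Graph n) (fas : Fascinating G) (S : Sub n) where

  three-inner-neighbours : ∀ v (ws : Three (adj G v ∩ side G S v)) → let open Three ws in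
    opposite G S v ≤ miss G S v + (miss G S w₁ + miss G S w₂ + miss G S w₃) + 6 * inner G S v
  three-inner-neighbours v ws@(three {w₁} {w₂} {w₃} p₁ p₂ p₃ _ _ _) =
    arith (opposite G S v) (cross G S v) (miss G S v) (miss G S w₁) (miss G S w₂) (miss G S w₃) (inner G S v)
      (opposite≡cross+miss G S v)
      (≤-trans (three-inner G fas (side G S v) v ws) (≤-reflexive
        (cong₂ (λ a b → a + b + 6 * inner G S v) (cong₂ _+_ (same w₁ p₁) (same w₂ p₂)) (same w₃ p₃))))
    where
    same : ∀ w → (adj G v ∩ side G S v) w ≡ true → count (∁ (adj G w) ∩ ∁ (side G S v)) ≡ miss G S w
    same w p = cong (λ b → count λ y → not (adj G w y) ∧ not (agree b (S y)))
      (agree⇒≡ (S v) (S w) (∩-⊆ʳ (adj G v) (side G S v) w p))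
    arith : ∀ o c m m₁ m₂ m₃ i → o ≡ c + m → c ≤ m₁ + m₂ + m₃ + 6 * i → o ≤ m + (m₁ + m₂ + m₃) + 6 * i
    arith _ c m m₁ m₂ m₃ i refl h = lin 0 h (solve (c ∷ m ∷ m₁ ∷ m₂ ∷ m₃ ∷ i ∷ []))

  module _ (K : ℕ) (6800≤K : 170 * 40 ≤ K) (1000<n : 40 * 25 < n)
           (opposite-large : ∀ v → 40 * n ≤ 2 * (40 * opposite G S v) + n)
           (inner-small : ∀ v → 20 * (6 * inner G S v) ≤ n)
           (inner-tiny : ∀ v → K * inner G S v ≤ n)
           (missing≤ : ∑ (miss G S) ≤ 17 * n)
           (missing≤inner : ∑ (miss G S) + n ≤ ∑ (inner G S)) where

    typical : Sub n
    typical v = 10 * miss G S v <ᵇ n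

    typical⇒< : ∀ v → typical v ≡ true → 1 + 10 * miss G S v ≤ n
    typical⇒< v t = <ᵇ⇒< _ _ (Equivalence.from T-≡ t)

    atypical⇒≥ : ∀ v → typical v ≡ false → n ≤ 10 * miss G S v
    atypical⇒≥ v t = ≮⇒≥ λ lt → true≢false (<ᵇ-true lt) t

    -- Four typical vertices miss less than 32n/80 and the inner degree costs at most 4n/80, but the
    -- other side has at least 39n/80 vertices.
    typical-inner≤2 : ∀ v → typical v ≡ true → count ((adj G v ∩ side G S v) ∩ typical) ≤ 2
    typical-inner≤2 v tv = ≮⇒≥ λ 3≤ → no-three (count-three _ 3≤)
      where
      arith : ∀ o m m₁ m₂ m₃ j → o ≤ m + (m₁ + m₂ + m₃) + j → 40 * n ≤ 2 * (40 * o) + n → 20 * j ≤ n →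
              1 + 10 * m ≤ n → 1 + 10 * m₁ ≤ n → 1 + 10 * m₂ ≤ n → 1 + 10 * m₃ ≤ n → ⊥
      arith o m m₁ m₂ m₃ j h h₁ h₂ k k₁ k₂ k₃ = absurd (31 + 3 * n)
        (80 ⊗ h ⊕ h₁ ⊕ 4 ⊗ h₂ ⊕ 8 ⊗ k ⊕ 8 ⊗ k₁ ⊕ 8 ⊗ k₂ ⊕ 8 ⊗ k₃)
        (solve (n ∷ o ∷ m ∷ m₁ ∷ m₂ ∷ m₃ ∷ j ∷ []))
      no-three : ¬ Three ((adj G v ∩ side G S v) ∩ typical)
      no-three ws@(three {w₁} {w₂} {w₃} p₁ p₂ p₃ _ _ _) =
        arith (opposite G S v) (miss G S v) (miss G S w₁) (miss G S w₂) (miss G S w₃) (6 * inner G S v)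
          (three-inner-neighbours v (three-map (∩-⊆ˡ (adj G v ∩ side G S v) typical) ws))
          (opposite-large v) (inner-small v) (typical⇒< v tv)
          (typical⇒< w₁ (∩-⊆ʳ (adj G v ∩ side G S v) typical w₁ p₁))
          (typical⇒< w₂ (∩-⊆ʳ (adj G v ∩ side G S v) typical w₂ p₂))
          (typical⇒< w₃ (∩-⊆ʳ (adj G v ∩ side G S v) typical w₃ p₃))

    all-typical⇒inner≤2 : (∀ v → 10 * miss G S v < n) → ∀ v → inner G S v ≤ 2
    all-typical⇒inner≤2 small v = ≤-trans
      (count-mono {p = adj G v ∩ side G S v} {q = (adj G v ∩ side G S v) ∩ typical}
        λ w h → ∧-intro h (<ᵇ-true {10 * miss G S w} {n} (small w)))
      (typical-inner≤2 v (<ᵇ-true {10 * miss G S v} {n} (small v)))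

    atypical-inner : ℕ
    atypical-inner = ∑ λ v → 𝟙 (not (typical v)) * inner G S v

    -- At an atypical vertex `K * inner` is at most `n`, hence at most `10 * miss`. So missing pairs
    -- pay for all inner edges there, however many atypical vertices exist.
    atypical-inner≤ : K * atypical-inner ≤ 10 * ∑ (miss G S)
    atypical-inner≤ = begin
      K * atypical-inner
        ≡⟨ sym (∑-* K (λ v → 𝟙 (not (typical v)) * inner G S v)) ⟩
      ∑ (λ v → K * (𝟙 (not (typical v)) * inner G S v))
        ≤⟨ ∑-mono (λ v → pw v (typical v) (atypical⇒≥ v)) ⟩
      ∑ (λ v → 10 * miss G S v)
        ≡⟨ ∑-* 10 (miss G S) ⟩
      10 * ∑ (miss G S) ∎
      where
      open ≤-Reasoning
      pw : ∀ v b → (b ≡ false → n ≤ 10 * miss G S v) → K * (𝟙 (not b) * inner G S v) ≤ 10 * miss G S v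
      pw v true  _ = ≤-trans (≤-reflexive (*-zeroʳ K)) z≤n
      pw v false h = ≤-trans (≤-reflexive (cong (K *_) (+-identityʳ (inner G S v)))) (≤-trans (inner-tiny v) (h refl))

    inner≤ : ∑ (inner G S) ≤ 2 * n + 2 * atypical-inner
    inner≤ = begin
      ∑ (inner G S)
        ≤⟨ ∑∑-mono (λ v w → pw (typical v) (typical w) (near v w)) ⟩
      ∑∑ (λ v w → 𝟙 (typical v) * 𝟙 (near v w ∧ typical w) +
                  (𝟙 (not (typical v)) * 𝟙 (near v w) + 𝟙 (not (typical w)) * 𝟙 (near v w)))
        ≡⟨ trans (∑∑-+ (λ v w → 𝟙 (typical v) * 𝟙 (near v w ∧ typical w))
                       (λ v w → 𝟙 (not (typical v)) * 𝟙 (near v w) + 𝟙 (not (typical w)) * 𝟙 (near v w)))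
             (cong (∑∑ (λ v w → 𝟙 (typical v) * 𝟙 (near v w ∧ typical w)) +_)
               (∑∑-+ (λ v w → 𝟙 (not (typical v)) * 𝟙 (near v w)) (λ v w → 𝟙 (not (typical w)) * 𝟙 (near v w)))) ⟩
      ∑∑ (λ v w → 𝟙 (typical v) * 𝟙 (near v w ∧ typical w)) +
        (∑∑ (λ v w → 𝟙 (not (typical v)) * 𝟙 (near v w)) + ∑∑ (λ v w → 𝟙 (not (typical w)) * 𝟙 (near v w)))
        ≤⟨ +-mono-≤ first (≤-reflexive (cong₂ _+_ second (trans third (sym (+-identityʳ atypical-inner))))) ⟩
      2 * n + 2 * atypical-inner ∎
      where
      open ≤-Reasoning
      ∑∑ : (Fin n → Fin n → ℕ) → ℕ
      ∑∑ h = ∑ λ x → ∑ (h x)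
      near : Fin n → Fin n → Bool
      near v w = adj G v w ∧ agree (S v) (S w)
      pw : ∀ a b c → 𝟙 c ≤ 𝟙 a * 𝟙 (c ∧ b) + (𝟙 (not a) * 𝟙 c + 𝟙 (not b) * 𝟙 c)
      pw = bool≤ 3 (λ a b c → 𝟙 c , 𝟙 a * 𝟙 (c ∧ b) + (𝟙 (not a) * 𝟙 c + 𝟙 (not b) * 𝟙 c)) refl
      first : ∑∑ (λ v w → 𝟙 (typical v) * 𝟙 (near v w ∧ typical w)) ≤ 2 * n
      first = ≤-trans (∑-mono λ v → ≤-trans (≤-reflexive (∑-* (𝟙 (typical v)) (λ w → 𝟙 (near v w ∧ typical w))))
          (at-most-2 v (typical v) (typical-inner≤2 v)))
        (≤-reflexive (trans (∑-const n 2) (*-comm n 2)))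
        where
        at-most-2 : ∀ v b → (b ≡ true → count ((adj G v ∩ side G S v) ∩ typical) ≤ 2) →
                    𝟙 b * count ((adj G v ∩ side G S v) ∩ typical) ≤ 2
        at-most-2 v true  h = ≤-trans (≤-reflexive (+-identityʳ _)) (h refl)
        at-most-2 v false h = z≤n
      second : ∑∑ (λ v w → 𝟙 (not (typical v)) * 𝟙 (near v w)) ≡ atypical-inner
      second = ∑-cong λ v → ∑-* (𝟙 (not (typical v))) (𝟙 ∘ near v)
      third : ∑∑ (λ v w → 𝟙 (not (typical w)) * 𝟙 (near v w)) ≡ atypical-inner
      third = trans (∑-swap (λ v w → 𝟙 (not (typical w)) * 𝟙 (near v w)))
        (trans (∑∑-cong λ w v → cong₂ (λ a b → 𝟙 (not (typical w)) * 𝟙 (a ∧ b)) (adj-sym G v w) (agree-sym (S v) (S w)))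
               second)

    few-missing : 20 * ∑ (miss G S) ≤ 21 * n
    few-missing = arith (∑ (inner G S)) (∑ (miss G S)) atypical-inner missing≤inner inner≤
      -- 170 is 10 · 17, from `atypical-inner≤` and `missing≤`. The factor 40 makes the atypical
      -- inner pairs at most n/40, hence n/20 after counting them from both ends.
      (cancel 170 40 atypical-inner (10 * ∑ (miss G S)) 6800≤K atypical-inner≤
        (≤-trans (10 ⊗ missing≤) (≤-reflexive (sym (*-assoc 10 17 n)))))
      where
      cancel : ∀ a b z m .{{_ : NonZero a}} → a * b ≤ K → K * z ≤ m → m ≤ a * n → b * z ≤ n
      cancel a b z m h k l = *-cancelˡ-≤ a (≤-trans (≤-reflexive (sym (*-assoc a b z)))
        (≤-trans (*-monoˡ-≤ z h) (≤-trans k l)))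
      arith : ∀ I M Z → M + n ≤ I → I ≤ 2 * n + 2 * Z → 40 * Z ≤ n → 20 * M ≤ 21 * n
      arith I M Z h₁ h₂ h₃ = lin 0 (20 ⊗ h₁ ⊕ 20 ⊗ h₂ ⊕ h₃) (solve (n ∷ I ∷ M ∷ Z ∷ []))

    -- v, three inner neighbours of v and x would together miss more pairs than there are.
    inner≤2-off : ∀ x → n ≤ 10 * miss G S x → ∀ v → x ≢ v → count ((adj G v ∩ side G S v) ∖ x) ≤ 2
    inner≤2-off x missed v x≢v = ≮⇒≥ λ 3≤ → no-three (count-three _ 3≤)
      where
      -- In units of n/80: `v` and its three neighbours miss at least 39 - 4 = 35 and `x` at least
      -- 8, which doubles to 86. Against this stand 84 from `few-missing` and less than 2 for the 25
      -- pairs among the five vertices.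
      arith : ∀ o m m₁ m₂ m₃ mₓ M j t → o ≤ m + (m₁ + m₂ + m₃) + j → 40 * n ≤ 2 * (40 * o) + n → 20 * j ≤ n →
              n ≤ 10 * mₓ → 20 * M ≤ 21 * n →
              2 * (mₓ + (m + (m₁ + (m₂ + (m₃ + 0))))) ≤ M + t → 1 + 40 * t ≤ n → ⊥
      arith o m m₁ m₂ m₃ mₓ M j t h₁ h₂ h₃ h₄ h₅ h₆ h₇ = absurd 0
        (80 ⊗ h₁ ⊕ h₂ ⊕ 4 ⊗ h₃ ⊕ 8 ⊗ h₄ ⊕ 2 ⊗ h₅ ⊕ 40 ⊗ h₆ ⊕ h₇)
        (solve (n ∷ o ∷ m ∷ m₁ ∷ m₂ ∷ m₃ ∷ mₓ ∷ M ∷ j ∷ t ∷ []))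
      no-three : ¬ Three ((adj G v ∩ side G S v) ∖ x)
      no-three (three {w₁} {w₂} {w₃} p₁ p₂ p₃ n₁₂ n₁₃ n₂₃) =
        let near = adj G v ∩ side G S v
            q₁ , x≢₁ = ∖-true near x w₁ p₁ ; q₂ , x≢₂ = ∖-true near x w₂ p₂ ; q₃ , x≢₃ = ∖-true near x w₃ p₃
            v≢ : ∀ w → (adj G v ∩ side G S v) w ≡ true → v ≢ w
            v≢ w q = adj⇒≢ G (∩-⊆ˡ (adj G v) (side G S v) w q)
        in arith (opposite G S v) (miss G S v) (miss G S w₁) (miss G S w₂) (miss G S w₃) (miss G S x)
          (∑ (miss G S)) (6 * inner G S v) 25
          (three-inner-neighbours v (three q₁ q₂ q₃ n₁₂ n₁₃ n₂₃)) (opposite-large v) (inner-small v)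
          missed few-missing
          (∑∑-rows {ts = x ∷ v ∷ w₁ ∷ w₂ ∷ w₃ ∷ []}
            ((x≢v All.∷ x≢₁ All.∷ x≢₂ All.∷ x≢₃ All.∷ All.[]) AllPairs.∷
             (v≢ w₁ q₁ All.∷ v≢ w₂ q₂ All.∷ v≢ w₃ q₃ All.∷ All.[]) AllPairs.∷
             (n₁₂ All.∷ n₁₃ All.∷ All.[]) AllPairs.∷ (n₂₃ All.∷ All.[]) AllPairs.∷ All.[] AllPairs.∷ AllPairs.[])
            (λ y z → not (adj G y z) ∧ not (agree (S y) (S z)))
            (λ y z → cong₂ (λ a b → not a ∧ not b) (adj-sym G y z) (agree-sym (S y) (S z))))
          1000<n

-- Links that are suspensions

count-full : ∀ {n} (p q : Sub n) → count p ≤ count (p ∩ q) → ∀ x → p x ≡ true → q x ≡ true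
count-full p q h x px = ∩-⊆ʳ p q x (𝟙-pos (≤-reflexive (trans (sym (cong 𝟙 px))
    (sym (∑-tight (λ y → pw (p y) (q y)) h x)))))
  where
  pw : ∀ a b → 𝟙 (a ∧ b) ≤ 𝟙 a
  pw = bool≤ 2 (λ a b → 𝟙 (a ∧ b) , 𝟙 a) refl

record Pair {n} (p : Sub n) : Set where
  field
    {p₁ p₂} : Fin n
    ∈₁      : p p₁ ≡ true
    ∈₂      : p p₂ ≡ true
    p₁≢p₂   : p₁ ≢ p₂
    only    : ∀ z → p z ≡ true → p₁ ≡ z ⊎ p₂ ≡ z

count-two : ∀ {n} (p : Sub n) → count p ≡ 2 → Pair p
count-two p two with count-pick p (≤-reflexive (sym two))
... | i , pi , 1≤ with count-pick (p ∖ i) 1≤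
...   | j , pj , _ with ∖-true p i j pj
...     | pj′ , i≢j = record { ∈₁ = pi ; ∈₂ = pj′ ; p₁≢p₂ = i≢j ; only = only }
  where
  only : ∀ z → p z ≡ true → i ≡ z ⊎ j ≡ z
  only z pz with i ≟ z | j ≟ z
  ... | yes e | _     = inj₁ e
  ... | _     | yes e = inj₂ e
  ... | no i≢z | no j≢z = contradiction
    (≤-trans (≤-reflexive (sym (cong₂ _+_ (cong₂ _+_ (cong 𝟙 pi) (cong 𝟙 pj′)) (cong 𝟙 pz))))
      (≤-trans (count-3 p i≢j i≢z j≢z) (≤-reflexive two))) λ { (s≤s (s≤s ())) }

module _ {n : ℕ} (G : Graph n) where

  -- Connectedness as an invariant: `R` is carried down the indices to `f F.zero` and up again.
  cycle-connected : ∀ {T k} → IsCycleOfLength G T k → (R : Fin n → Set) →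
    (∀ y z → T y ≡ true → T z ≡ true → adj G y z ≡ true → R y → R z) →
    ∀ y → T y ≡ true → R y → ∀ z → T z ≡ true → R z
  cycle-connected {T} {suc k} (_ , f , _ , mem , cyc) R closed y Ty Ry z Tz
    with i , fi≡y ← Equivalence.to (mem y) Ty | j , fj≡z ← Equivalence.to (mem z) Tz
    = subst R fj≡z (up (down i (subst R (sym fi≡y) Ry)) j)
    where
    Tf : ∀ i → T (f i) ≡ true
    Tf i = Equivalence.from (mem (f i)) (i , refl)
    ≡ᵇ-refl : ∀ m → (m ≡ᵇ m) ≡ true
    ≡ᵇ-refl m = Equivalence.to T-≡ (≡⇒≡ᵇ m m refl)
    ∨-introˡ : ∀ {a b} → a ≡ true → a ∨ b ≡ true
    ∨-introˡ refl = refl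
    next : ∀ i → adj G (f (F.inject₁ i)) (f (F.suc i)) ≡ true
    next i = trans (cyc (F.inject₁ i) (F.suc i)) (∨-introˡ
      (trans (cong (toℕ i ≡ᵇ_) (toℕ-inject₁ i)) (≡ᵇ-refl (toℕ i))))
    up : R (f F.zero) → ∀ j → R (f j)
    up r = <-weakInduction (R ∘ f) r λ i → closed _ _ (Tf (F.inject₁ i)) (Tf (F.suc i)) (next i)
    down : ∀ i → R (f i) → R (f F.zero)
    down = <-weakInduction (λ i → R (f i) → R (f F.zero)) id λ i ih r →
      ih (closed _ _ (Tf (F.suc i)) (Tf (F.inject₁ i)) (trans (adj-sym G _ _) (next i)) r)

module _ {n : ℕ} (G : Graph n) (fas : Fascinating G) (P : Sub n) (v : Fin n) where

  private
    X Y : Sub n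
    X = adj G v ∩ P
    Y = adj G v ∩ ∁ P

    X⊆ : ∀ x → X x ≡ true → adj G v x ≡ true
    X⊆ = ∩-⊆ˡ (adj G v) P

    Y⊆ : ∀ x → Y x ≡ true → adj G v x ≡ true
    Y⊆ = ∩-⊆ˡ (adj G v) (∁ P)

    link-count : e G X X + 2 * e G X Y + e G Y Y + 12 ≡ 6 * (count X + count Y)
    link-count = trans (cong (_+ 12) (sym (e-split G (adj G v) P)))
      (trans (link-edges G fas v) (cong (6 *_) (count-split (adj G v) P)))

  -- Every triangle of the link with an edge between X and Y has exactly two such edges.
  crossing-edges : e G X Y + 4 ≤ 2 * (count X + count Y)
  crossing-edges = arith (count X) (count Y) (e G X X) (e G X Y) (e G Y Y) link-count (begin
    2 * e G X Y
      ≡⟨ sym (trans (∑-cong λ p → ∑-* 2 (λ q → 𝟙 (X p ∧ Y q ∧ adj G p q)))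
                    (∑-* 2 (λ p → ∑ λ q → 𝟙 (X p ∧ Y q ∧ adj G p q)))) ⟩
    ∑ (λ p → ∑ λ q → 2 * 𝟙 (X p ∧ Y q ∧ adj G p q))
      ≤⟨ ∑∑-mono (λ p q → third-vertex p q) ⟩
    ∑ (λ p → ∑ λ q → t₁ p q + t₂ q p)
      ≡⟨ trans (∑∑-+ t₁ (λ p q → t₂ q p)) (cong (∑ (λ p → ∑ (t₁ p)) +_) (∑-swap (λ p q → t₂ q p))) ⟩
    ∑ (λ p → ∑ (t₁ p)) + ∑ (λ q → ∑ (t₂ q))
      ≤⟨ +-mono-≤ (triangles≤ X Y X⊆ Y⊆) (triangles≤ Y X Y⊆ X⊆) ⟩
    2 * e G X X + 2 * e G Y Y ∎)
    where
    open ≤-Reasoning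
    arith : ∀ x y XX XY YY → XX + 2 * XY + YY + 12 ≡ 6 * (x + y) → 2 * XY ≤ 2 * XX + 2 * YY →
            XY + 4 ≤ 2 * (x + y)
    arith x y XX XY YY h k = *-cancelˡ-≤ 6
      (lin 0 (2 ⊗ ≤-reflexive h ⊕ k) (solve (x ∷ y ∷ XX ∷ XY ∷ YY ∷ [])))
    -- Triangles of the link with two vertices in `U` and one in `W`, listed by a crossing edge
    -- `p q`. Grouped by `p`, they are charged to their edge inside `U`, which lies in only two
    -- triangles of the link.
    t : Sub n → Sub n → Fin n → Fin n → ℕ
    t U W p q = 𝟙 (U p) * (𝟙 (W q ∧ adj G p q) * count ((U ∩ adj G p) ∩ adj G q))
    t₁ t₂ : Fin n → Fin n → ℕ
    t₁ = t X Y
    t₂ = t Y X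
    triangles≤ : ∀ U W → (∀ x → U x ≡ true → adj G v x ≡ true) → (∀ x → W x ≡ true → adj G v x ≡ true) →
                 ∑ (λ p → ∑ (t U W p)) ≤ 2 * e G U U
    triangles≤ U W U⊆ W⊆ = begin
      ∑ (λ p → ∑ (t U W p))
        ≡⟨ ∑-cong (λ p → trans (∑-* (𝟙 (U p)) (λ q → 𝟙 (W q ∧ adj G p q) * count ((U ∩ adj G p) ∩ adj G q)))
             (cong (𝟙 (U p) *_) (trans (sym (e-rows G (W ∩ adj G p) (U ∩ adj G p)))
                                       (e-sym G (W ∩ adj G p) (U ∩ adj G p))))) ⟩
      ∑ (λ p → 𝟙 (U p) * e G (U ∩ adj G p) (W ∩ adj G p))
        ≤⟨ ∑-mono (λ p → row p (U p) refl) ⟩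
      ∑ (λ p → 2 * (𝟙 (U p) * count (U ∩ adj G p)))
        ≡⟨ trans (∑-* 2 (λ p → 𝟙 (U p) * count (U ∩ adj G p))) (cong (2 *_) (sym (e-rows G U U))) ⟩
      2 * e G U U ∎
      where
      row : ∀ p b → U p ≡ b → 𝟙 b * e G (U ∩ adj G p) (W ∩ adj G p) ≤ 2 * (𝟙 b * count (U ∩ adj G p))
      row p false _  = z≤n
      row p true  Up = ≤-trans (≤-reflexive (+-identityʳ _)) (≤-trans
        (clique-bound G fas v p U W (U⊆ p Up) U⊆ W⊆) (≤-reflexive (cong (2 *_) (sym (+-identityʳ (count (U ∩ adj G p)))))))
    third-vertex : ∀ p q → 2 * 𝟙 (X p ∧ Y q ∧ adj G p q) ≤ t₁ p q + t₂ q p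
    third-vertex p q = cases (X p) (Y q) (adj G p q) refl refl refl
      where
      cases : ∀ a b c → X p ≡ a → Y q ≡ b → adj G p q ≡ c → 2 * 𝟙 (a ∧ b ∧ c) ≤ t₁ p q + t₂ q p
      cases false _     _     _ _ _ = z≤n
      cases true  false _     _ _ _ = z≤n
      cases true  true  false _ _ _ = z≤n
      cases true  true  true  Xp Yq pq
        rewrite Xp | Yq | pq | trans (adj-sym G q p) pq = begin
          2
            ≡⟨ sym (link-triangle G fas v p q (X⊆ p Xp) pq (Y⊆ q Yq)) ⟩
          count L
            ≡⟨ count-split L P ⟩
          count (L ∩ P) + count (L ∩ ∁ P)
            ≤⟨ +-mono-≤
                 (∑-mono λ z → bool≤ 4 (λ vz pz qz z∈P → 𝟙 ((vz ∧ pz ∧ qz) ∧ z∈P) , 𝟙 (((vz ∧ z∈P) ∧ pz) ∧ qz)) refl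
                   (adj G v z) (adj G p z) (adj G q z) (P z))
                 (∑-mono λ z → bool≤ 4 (λ vz pz qz z∈P → 𝟙 ((vz ∧ pz ∧ qz) ∧ not z∈P) ,
                                                         𝟙 (((vz ∧ not z∈P) ∧ qz) ∧ pz)) refl
                   (adj G v z) (adj G p z) (adj G q z) (P z)) ⟩
          count ((X ∩ adj G p) ∩ adj G q) + count ((Y ∩ adj G q) ∩ adj G p)
            ≡⟨ sym (cong₂ _+_ (double-identity (count ((X ∩ adj G p) ∩ adj G q))) (double-identity (count ((Y ∩ adj G q) ∩ adj G p)))) ⟩
          1 * (1 * count ((X ∩ adj G p) ∩ adj G q)) + 1 * (1 * count ((Y ∩ adj G q) ∩ adj G p)) ∎
        where
        L : Sub n
        L z = adj G v z ∧ adj G p z ∧ adj G q z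
        double-identity : ∀ m → 1 * (1 * m) ≡ m
        double-identity m = solve (m ∷ [])

  record Suspension : Set where
    field
      poles       : Pair X
      nonadjacent : adj G (Pair.p₁ poles) (Pair.p₂ poles) ≡ false
      full        : ∀ x y → X x ≡ true → Y y ≡ true → adj G x y ≡ true
      two-regular : ∀ y → Y y ≡ true → count (Y ∩ adj G y) ≡ 2

  -- When the part of the link of v outside P has degrees at most 2, counting edges leaves no room:
  -- the link is the suspension of a 2-regular graph.
  suspension : count X ≤ 2 → 4 ≤ count Y → (∀ y → Y y ≡ true → count (Y ∩ adj G y) ≤ 2) → Suspension
  suspension x≤2 4≤y deg≤2 = by-count (count X) refl x≤2
    where
    YY≤ : e G Y Y ≤ 2 * count Y
    YY≤ = e-≤ G Y Y 2 deg≤2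

    XY≤ : ∀ {k} → count X ≡ k → e G X Y ≤ k * count Y
    XY≤ {k} eq = ≤-trans (≤-reflexive (e-sym G X Y)) (e-≤ G Y X k λ y _ →
      ≤-trans (count-mono (∩-⊆ˡ X (adj G y))) (≤-reflexive eq))

    XX≤ : ∀ {k} → count X ≡ suc k → e G X X ≤ k * suc k
    XX≤ {k} eq = ≤-trans (e-≤ G X X k λ x Xx → ≤-pred (≤-trans
        (s≤s (count-mono λ y h → let Xy , xy = ∧-true {X y} h in
          ∧-intro Xy (cong not (≢⇒== (adj⇒≢ G xy)))))
        (≤-reflexive (trans (cong (λ b → 𝟙 b + count (X ∖ x)) (sym Xx)) (trans (sym (count-∖ X x)) eq)))))
      (≤-reflexive (cong (k *_) eq))

    -- Here, for a single vertex in `X`, and for two adjacent ones, the edge count would force y ≤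
    -- 3; this is the origin of the bound `4 ≤ count Y`.
    none : ∀ y XX XY YY → XX + 2 * XY + YY + 12 ≡ 6 * (0 + y) → XX ≤ 0 → XY ≤ 0 → YY ≤ 2 * y → 4 ≤ y → Suspension
    none y XX XY YY h h₁ h₂ h₃ h₄ = absurd 3
      (≤-reflexive (sym h) ⊕ h₁ ⊕ 2 ⊗ h₂ ⊕ h₃ ⊕ 4 ⊗ h₄) (solve (y ∷ XX ∷ XY ∷ YY ∷ []))

    one : ∀ y XX XY YY → XX + 2 * XY + YY + 12 ≡ 6 * (1 + y) → XX ≤ 0 → XY ≤ 1 * y → YY ≤ 2 * y → 4 ≤ y → Suspension
    one y XX XY YY h h₁ h₂ h₃ h₄ = absurd 1
      (≤-reflexive (sym h) ⊕ h₁ ⊕ 2 ⊗ h₂ ⊕ h₃ ⊕ 2 ⊗ h₄) (solve (y ∷ XX ∷ XY ∷ YY ∷ []))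

    two : count X ≡ 2 → Pair X → Suspension
    two eq pair = by-adjacency (adj G p₁ p₂) refl
      where
      open Pair pair
      at-most : ∀ y → count (X ∩ adj G y) ≤ 𝟙 (adj G p₁ y) + 𝟙 (adj G p₂ y)
      at-most y = ≤-trans (∑-mono pw) (≤-reflexive (trans
          (∑-+ (λ z → 𝟙 (p₁ == z) * 𝟙 (adj G z y)) (λ z → 𝟙 (p₂ == z) * 𝟙 (adj G z y)))
          (cong₂ _+_ (∑-δ p₁ (λ z → 𝟙 (adj G z y))) (∑-δ p₂ (λ z → 𝟙 (adj G z y))))))
        where
        pw : ∀ z → 𝟙 (X z ∧ adj G y z) ≤ 𝟙 (p₁ == z) * 𝟙 (adj G z y) + 𝟙 (p₂ == z) * 𝟙 (adj G z y)
        pw z with X z in Xz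
        ... | false = z≤n
        ... | true with only z Xz
        ...   | inj₁ refl rewrite ==-refl p₁ | adj-sym G y p₁ =
          ≤-trans (m≤m+n _ 0) (m≤m+n (𝟙 (adj G p₁ y) + 0) _)
        ...   | inj₂ refl rewrite ==-refl p₂ | adj-sym G y p₂ =
          ≤-trans (m≤m+n _ 0) (m≤n+m (𝟙 (adj G p₂ y) + 0) (𝟙 (p₁ == p₂) * 𝟙 (adj G p₂ y)))

      -- Adjacent poles would form a triangle with `v`, and just two vertices complete it; all other
      -- vertices of `Y` see at most one pole.
      adjacent-poles : adj G p₁ p₂ ≡ true → e G X Y ≤ count Y + 2
      adjacent-poles a = begin
        e G X Y
          ≡⟨ trans (e-sym G X Y) (e-rows G Y X) ⟩
        ∑ (λ y → 𝟙 (Y y) * count (X ∩ adj G y))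
          ≤⟨ ∑-mono (λ y → *-monoʳ-≤ (𝟙 (Y y)) (at-most y)) ⟩
        ∑ (λ y → 𝟙 (Y y) * (𝟙 (adj G p₁ y) + 𝟙 (adj G p₂ y)))
          ≤⟨ ∑-mono (λ y → bool≤ 4 (λ vy y∈P y₁ y₂ → 𝟙 (vy ∧ not y∈P) * (𝟙 y₁ + 𝟙 y₂) ,
               𝟙 (vy ∧ not y∈P) + 𝟙 (vy ∧ y₁ ∧ y₂)) refl (adj G v y) (P y) (adj G p₁ y) (adj G p₂ y)) ⟩
        ∑ (λ y → 𝟙 (Y y) + 𝟙 (adj G v y ∧ adj G p₁ y ∧ adj G p₂ y))
          ≡⟨ trans (∑-+ (𝟙 ∘ Y) (λ y → 𝟙 (adj G v y ∧ adj G p₁ y ∧ adj G p₂ y)))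
               (cong (count Y +_) (link-triangle G fas v p₁ p₂ (X⊆ p₁ ∈₁) a (X⊆ p₂ ∈₂))) ⟩
        count Y + 2 ∎
        where open ≤-Reasoning

      arith₁ : ∀ y XX XY YY → XX + 2 * XY + YY + 12 ≡ 6 * (2 + y) → XX ≤ 2 → XY ≤ y + 2 → YY ≤ 2 * y → 4 ≤ y → ⊥
      arith₁ y XX XY YY h h₁ h₂ h₃ h₄ = absurd 1
        (≤-reflexive (sym h) ⊕ h₁ ⊕ 2 ⊗ h₂ ⊕ h₃ ⊕ 2 ⊗ h₄) (solve (y ∷ XX ∷ XY ∷ YY ∷ []))

      independent : adj G p₁ p₂ ≡ false → e G X X ≤ 0
      independent a = e-≤ G X X 0 λ x Xx → ≮⇒≥ λ 1≤ → case count-pick (X ∩ adj G x) 1≤ of λ where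
        (y , h , _) → let Xy , xy = ∧-true {X y} h in case only x Xx , only y Xy of λ where
          (inj₁ refl , inj₁ refl) → true≢false xy (adj-irrefl G p₁)
          (inj₁ refl , inj₂ refl) → true≢false xy a
          (inj₂ refl , inj₁ refl) → true≢false xy (trans (adj-sym G p₂ p₁) a)
          (inj₂ refl , inj₂ refl) → true≢false xy (adj-irrefl G p₂)

      -- With nonadjacent poles the count reads 2 XY + YY = 6y, while XY and YY are both at most 2y,
      -- so both bounds are attained.
      arith₂ : ∀ y XX XY YY → XX + 2 * XY + YY + 12 ≡ 6 * (2 + y) → XX ≤ 0 → YY ≤ 2 * y → 2 * y ≤ XY
      arith₂ y XX XY YY h h₁ h₂ = *-cancelˡ-≤ 2
        (lin 0 (≤-reflexive (sym h) ⊕ h₁ ⊕ h₂) (solve (y ∷ XX ∷ XY ∷ YY ∷ [])))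

      arith₃ : ∀ y XX XY YY → XX + 2 * XY + YY + 12 ≡ 6 * (2 + y) → XX ≤ 0 → XY ≤ 2 * y → 2 * y ≤ YY
      arith₃ y XX XY YY h h₁ h₂ =
        lin 0 (≤-reflexive (sym h) ⊕ h₁ ⊕ 2 ⊗ h₂) (solve (y ∷ XX ∷ XY ∷ YY ∷ []))

      rows-tight : ∀ W → (∀ y → Y y ≡ true → count (W ∩ adj G y) ≤ 2) → 2 * count Y ≤ e G Y W →
                   ∀ y → Y y ≡ true → count (W ∩ adj G y) ≡ 2
      rows-tight W ≤2 h y Yy = trans (sym (+-identityʳ _)) (trans (cong (λ b → 𝟙 b * count (W ∩ adj G y)) (sym Yy))
        (trans (∑-tight {f = λ y → 𝟙 (Y y) * count (W ∩ adj G y)} {g = λ y → 2 * 𝟙 (Y y)} (λ y → pw y (Y y) refl)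
          (≤-trans (≤-reflexive (∑-* 2 (𝟙 ∘ Y))) (≤-trans h (≤-reflexive (e-rows G Y W)))) y)
          (cong (λ b → 2 * 𝟙 b) Yy)))
        where
        pw : ∀ y b → Y y ≡ b → 𝟙 b * count (W ∩ adj G y) ≤ 2 * 𝟙 b
        pw y false _  = z≤n
        pw y true  Yy = ≤-trans (≤-reflexive (+-identityʳ _)) (≤2 y Yy)

      eq-count : e G X X + 2 * e G X Y + e G Y Y + 12 ≡ 6 * (2 + count Y)
      eq-count = trans link-count (cong (λ m → 6 * (m + count Y)) eq)

      by-adjacency : ∀ b → adj G p₁ p₂ ≡ b → Suspension
      by-adjacency true  a = ⊥-elim (arith₁ (count Y) (e G X X) (e G X Y) (e G Y Y) eq-count (XX≤ eq)
        (adjacent-poles a) YY≤ 4≤y)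
      by-adjacency false a = record
        { poles       = pair
        ; nonadjacent = a
        ; full        = λ x y Xx Yy → trans (adj-sym G x y) (count-full X (adj G y)
            (≤-reflexive (trans eq (sym (rows-tight X
              (λ z _ → ≤-trans (count-mono (∩-⊆ˡ X (adj G z))) (≤-reflexive eq))
              (≤-trans (arith₂ (count Y) (e G X X) (e G X Y) (e G Y Y) eq-count (independent a) YY≤)
                       (≤-reflexive (e-sym G X Y))) y Yy)))) x Xx)
        ; two-regular = rows-tight Y deg≤2
            (arith₃ (count Y) (e G X X) (e G X Y) (e G Y Y) eq-count (independent a) (XY≤ eq))
        }

    by-count : ∀ k → count X ≡ k → k ≤ 2 → Suspension
    by-count 0 eq _ = none (count Y) (e G X X) (e G X Y) (e G Y Y)
      (trans link-count (cong (λ m → 6 * (m + count Y)) eq))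
      (≤-trans (e-≤ G X X n λ x _ → count≤n (X ∩ adj G x)) (≤-reflexive (trans (cong (n *_) eq) (*-zeroʳ n))))
      (XY≤ eq) YY≤ 4≤y
    by-count 1 eq _ = one (count Y) (e G X X) (e G X Y) (e G Y Y)
      (trans link-count (cong (λ m → 6 * (m + count Y)) eq)) (XX≤ eq) (XY≤ eq) YY≤ 4≤y
    by-count 2 eq _ = two eq (count-two X eq)
    by-count (suc (suc (suc _))) _ (s≤s (s≤s ()))

-- The join when no vertex is exceptional

cycle-cong : ∀ {n} (G : Graph n) {S T : Sub n} → (∀ x → S x ≡ T x) → IsCycle G S → IsCycle G T
cycle-cong G S≗T (k , 3≤k , f , inj , mem , cyc) = k , 3≤k , f , inj ,
  (λ x → mk⇔ (Equivalence.to (mem x) ∘ trans (S≗T x)) (trans (sym (S≗T x)) ∘ Equivalence.from (mem x))) , cyc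

iff⇒≡ : ∀ {a b} → (a ≡ true → b ≡ true) → (b ≡ true → a ≡ true) → a ≡ b
iff⇒≡ {true}  f g = sym (f refl)
iff⇒≡ {false} {false} f g = refl
iff⇒≡ {false} {true}  f g = g refl

opposite-trans : ∀ a b c → not (agree a b) ≡ true → not (agree a c) ≡ true → agree b c ≡ true
opposite-trans true  false false _ _ = refl
opposite-trans false true  true  _ _ = refl

opposite-agree : ∀ a b c → agree a b ≡ true → not (agree a c) ≡ true → not (agree b c) ≡ true
opposite-agree true  true  false _ _ = refl
opposite-agree false false true  _ _ = refl

module _ {n : ℕ} (G : Graph n) (fas : Fascinating G) where
  open Fascinating fas

  module _ (P : Sub n) (v : Fin n) (susp : Suspension G fas P v) where
    open Suspension susp
    open Pair poles

    -- The set is the link of the edge from `v` to a pole, hence a single cycle; `two-regular` by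
    -- itself would allow several.
    link-of-pole : IsCycle G (adj G v ∩ ∁ P)
    link-of-pole with fb v p₁ (∩-⊆ˡ (adj G v) P p₁ ∈₁)
    ... | k , _ , cyc = cycle-cong G (λ x → iff⇒≡ (λ h → ∧-intro (proj₁ (∧-true h)) (outside x h))
        (λ Yx → ∧-intro (∩-⊆ˡ (adj G v) (∁ P) x Yx) (full p₁ x ∈₁ Yx))) (k , cyc)
      where
      outside : ∀ x → adj G v x ∧ adj G p₁ x ≡ true → not (P x) ≡ true
      outside x h with P x in Px
      ... | false = refl
      ... | true  = let vx , p₁x = ∧-true {adj G v x} h in case only x (∧-intro vx Px) of λ where
        (inj₁ refl) → true≢false p₁x (adj-irrefl G p₁)
        (inj₂ refl) → true≢false p₁x nonadjacent

  module _ (S : Sub n) (1000<n : 1000 < n)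
           (opposite-large : ∀ v → 40 * n ≤ 2 * (40 * opposite G S v) + n)
           (inner≤2 : ∀ v → inner G S v ≤ 2) (miss-small : ∀ v → 10 * miss G S v < n) where

    private
      Y : Fin n → Sub n
      Y v = adj G v ∩ ∁ (side G S v)

      Y-sym : ∀ v y → Y v y ≡ true → Y y v ≡ true
      Y-sym v y h rewrite adj-sym G y v | agree-sym (S y) (S v) = h

      many-cross : ∀ v → 4 ≤ cross G S v
      many-cross v = arith (opposite G S v) (cross G S v) (miss G S v) (opposite≡cross+miss G S v)
          (opposite-large v) (miss-small v) (≤-trans (m≤m+n 11 990) 1000<n)
        where
        arith : ∀ o c m → o ≡ c + m → 40 * n ≤ 2 * (40 * o) + n → 1 + 10 * m ≤ n → 11 ≤ n → 4 ≤ c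
        arith _ c m refl h k l = *-cancelˡ-≤ 80 (lin 29 (h ⊕ 8 ⊗ k ⊕ 31 ⊗ l) (solve (n ∷ c ∷ m ∷ [])))

      susp : ∀ v → Suspension G fas (side G S v) v
      susp v = suspension G fas (side G S v) v (inner≤2 v) (many-cross v) λ y Yy → ≤-trans
        (count-mono λ z h → let Yz , yz = ∧-true {Y v z} h in ∧-intro yz
          (opposite-trans (S v) (S y) (S z) (∩-⊆ʳ (adj G v) (∁ (side G S v)) y Yy)
                                            (∩-⊆ʳ (adj G v) (∁ (side G S v)) z Yz)))
        (inner≤2 y)

      -- The two neighbours of `y` inside `Y v` already exhaust its inner degree.
      closed : ∀ v y z → Y v y ≡ true → not (side G S v z) ≡ true → adj G y z ≡ true → Y v z ≡ true
      closed v y z Yy oz yz = ∧-intro (count-full (adj G y ∩ side G S y) (adj G v)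
          (≤-trans (inner≤2 y) (≤-trans (≤-reflexive (sym (Suspension.two-regular (susp v) y Yy)))
            (count-mono λ u h → let Yu , yu = ∧-true {Y v u} h in
              ∧-intro (∧-intro yu (same u (∩-⊆ʳ (adj G v) (∁ (side G S v)) u Yu)))
                      (∩-⊆ˡ (adj G v) (∁ (side G S v)) u Yu))))
          z (∧-intro yz (same z oz))) oz
        where
        same : ∀ u → not (side G S v u) ≡ true → side G S y u ≡ true
        same u = opposite-trans (S v) (S y) (S u) (∩-⊆ʳ (adj G v) (∁ (side G S v)) y Yy)

      -- Each of the two misses less than n/10 of an opposite side with at least 39n/80 vertices.
      common : ∀ v w → side G S v w ≡ true → ∃[ y ] (Y v y ≡ true × Y w y ≡ true)
      common v w vw = case count-pick (Y v ∩ Y w)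
          (arith (opposite G S v) (miss G S v) (miss G S w) (count (Y v ∩ Y w))
            cover (opposite-large v) (miss-small v) (miss-small w)) of λ where
          (y , h , _) → y , ∧-true {Y v y} h
        where
        arith : ∀ o m₁ m₂ c → o ≤ m₁ + m₂ + c → 40 * n ≤ 2 * (40 * o) + n → 1 + 10 * m₁ ≤ n → 1 + 10 * m₂ ≤ n → 1 ≤ c
        arith o m₁ m₂ c h k l₁ l₂ = ≮⇒≥ λ { (s≤s c≤0) → contradict c≤0 }
          where
          contradict : c ≤ 0 → ⊥
          contradict c≤0 = absurd (15 + 23 * n) (80 ⊗ h ⊕ k ⊕ 8 ⊗ l₁ ⊕ 8 ⊗ l₂ ⊕ 80 ⊗ c≤0)
            (solve (n ∷ o ∷ m₁ ∷ m₂ ∷ c ∷ []))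
        cover : opposite G S v ≤ miss G S v + miss G S w + count (Y v ∩ Y w)
        cover rewrite sym (agree⇒≡ (S v) (S w) vw) = ≤-trans
          (∑-mono λ y → bool≤ 3 (λ a b o → 𝟙 (not o) , 𝟙 (not a ∧ not o) + 𝟙 (not b ∧ not o) + 𝟙 ((a ∧ not o) ∧ (b ∧ not o)))
            refl (adj G v y) (adj G w y) (agree (S v) (S y)))
          (≤-reflexive (trans (∑-+ (λ y → 𝟙 (not (adj G v y) ∧ not (agree (S v) (S y))) + 𝟙 (not (adj G w y) ∧ not (agree (S v) (S y))))
            (𝟙 ∘ λ y → (adj G v y ∧ not (agree (S v) (S y))) ∧ (adj G w y ∧ not (agree (S v) (S y)))))
            (cong (_+ count λ y → (adj G v y ∧ not (agree (S v) (S y))) ∧ (adj G w y ∧ not (agree (S v) (S y))))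
              (∑-+ (λ y → 𝟙 (not (adj G v y) ∧ not (agree (S v) (S y)))) (λ y → 𝟙 (not (adj G w y) ∧ not (agree (S v) (S y))))))))

      -- The cycle on `Y v` meets `Y w`, and by `closed` a walk along it can never leave `Y w`.
      same-link : ∀ v w → side G S v w ≡ true → ∀ y → Y v y ≡ true → Y w y ≡ true
      same-link v w vw y Yvy =
        let x , Yvx , Ywx = common v w vw
            _ , cyc = link-of-pole (side G S v) v (susp v)
        in cycle-connected G cyc (λ z → Y w z ≡ true)
          (λ a b _ Yvb ab Ywa → closed w a b Ywa
            (opposite-agree (S v) (S w) (S b) vw (∩-⊆ʳ (adj G v) (∁ (side G S v)) b Yvb)) ab)
          x Yvx Ywx y Yvy

      -- Any cross neighbour `z` of `v` lies on the side of `y`, so `same-link` makes the cross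
      -- neighbours of `z`, among them `v`, neighbours of `y`.
      complete : ∀ v y → not (side G S v y) ≡ true → adj G v y ≡ true
      complete v y vy = case count-pick (Y v) (≤-trans (s≤s z≤n) (many-cross v)) of λ where
        (z , Yz , _) → trans (adj-sym G v y) (∩-⊆ˡ (adj G y) (∁ (side G S y)) v (same-link z y
          (opposite-trans (S v) (S z) (S y) (∩-⊆ʳ (adj G v) (∁ (side G S v)) z Yz) vy) v (Y-sym v z Yz)))

      opposite-cycle : ∀ v → IsCycle G (∁ (side G S v))
      opposite-cycle v = cycle-cong G (λ y → iff⇒≡ (∩-⊆ʳ (adj G v) (∁ (side G S v)) y)
        (λ o → ∧-intro (complete v y o) o)) (link-of-pole (side G S v) v (susp v))

    join : IsJoinOfTwoCycles G
    join = S , in-S , out-S , λ a b Sa Sb → complete a b (cong₂ (λ p q → not (agree p q)) Sa Sb)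
      where
      both : ∃[ a ] ∃[ b ] (S a ≡ true × S b ≡ false)
      both with count-pick {n} everything (≤-trans (≤-trans (s≤s z≤n) 1000<n) (≤-reflexive (sym (count-all n))))
      ... | v , _ with count-pick (Y v) (≤-trans (s≤s z≤n) (many-cross v))
      ...   | y , Yy , _ with S v in Sv | S y in Sy | ∩-⊆ʳ (adj G v) (∁ (side G S v)) y Yy
      ...     | true  | false | _ = v , y , Sv , Sy
      ...     | false | true  | _ = y , v , Sy , Sv
      ...     | true  | true  | ()
      ...     | false | false | ()
      in-S : IsCycle G S
      in-S = let _ , b , _ , Sb = both in
        cycle-cong G (λ x → trans (cong (λ q → not (agree q (S x))) Sb) (not-involutive (S x))) (opposite-cycle b)
      out-S : IsCycle G (not ∘ S)
      out-S = let a , _ , Sa , _ = both in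
        cycle-cong G (λ x → cong (λ q → not (agree q (S x))) Sa) (opposite-cycle a)

-- Counting around an exceptional vertex

∑-3 : ∀ {n} (f : Fin n → ℕ) {x y z : Fin n} → x ≢ y → x ≢ z → y ≢ z → f x + (f y + (f z + 0)) ≤ ∑ f
∑-3 f {x} {y} {z} x≢y x≢z y≢z = ≤-trans (≤-reflexive (sym (∑-multiplicity ts f)))
  (∑-mono λ i → ≤-trans (*-monoˡ-≤ (f i) (multiplicity≤1 distinct i)) (≤-reflexive (*-identityˡ (f i))))
  where
  ts : List _
  ts = x ∷ y ∷ z ∷ []
  distinct : Unique ts
  distinct = (x≢y All.∷ x≢z All.∷ All.[]) AllPairs.∷ (y≢z All.∷ All.[]) AllPairs.∷ All.[] AllPairs.∷ AllPairs.[]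

module _ {n : ℕ} (G : Graph n) (fas : Fascinating G) (dense : n * n + 2 * n + 17 < 2 * ∑ (deg G)) (x : Fin n) where
  open Fascinating fas

  private
    others : Sub n
    others y = not (x == y)

  module _ (P : Sub n) (inner≤2 : ∀ v → x ≢ v → count ((adj G v ∩ side G P v) ∖ x) ≤ 2) where

    private
      A B X Y : Sub n
      A = others ∩ P
      B = others ∩ ∁ P
      X = adj G x ∩ P
      Y = adj G x ∩ ∁ P

      α β a b M : ℕ
      α = count A
      β = count B
      a = count X
      b = count Y
      M = ē G A B

      others⇒≢ : ∀ v → others v ≡ true → x ≢ v
      others⇒≢ v h = ==⇒≢ (not-true h)

      adj⇒others : ∀ v → adj G x v ≡ true → others v ≡ true
      adj⇒others v h = cong not (≢⇒== (adj⇒≢ G h))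

      X⊆A : ∀ v → X v ≡ true → A v ≡ true
      X⊆A v h = let xv , Pv = ∧-true {adj G x v} h in ∧-intro (adj⇒others v xv) Pv

      Y⊆B : ∀ v → Y v ≡ true → B v ≡ true
      Y⊆B v h = let xv , Pv = ∧-true {adj G x v} h in ∧-intro (adj⇒others v xv) Pv

      A-deg : ∀ v → A v ≡ true → count (A ∩ adj G v) ≤ 2
      A-deg v Av = let ov , Pv = ∧-true {others v} Av in ≤-trans
        (count-mono λ w h → let Aw , vw = ∧-true {A w} h ; ow , Pw = ∧-true {others w} Aw in
          ∧-intro (∧-intro vw (cong₂ agree Pv Pw)) ow)
        (inner≤2 v (others⇒≢ v ov))

      B-deg : ∀ v → B v ≡ true → count (B ∩ adj G v) ≤ 2
      B-deg v Bv = let ov , Pv = ∧-true {others v} Bv in ≤-trans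
        (count-mono λ w h → let Bw , vw = ∧-true {B w} h ; ow , Pw = ∧-true {others w} Bw in
          ∧-intro (∧-intro vw (cong₂ agree (not-true Pv) (not-true Pw))) ow)
        (inner≤2 v (others⇒≢ v ov))

      AA≤ : e G A A ≤ 2 * α
      AA≤ = e-≤ G A A 2 A-deg

      BB≤ : e G B B ≤ 2 * β
      BB≤ = e-≤ G B B 2 B-deg

      count-x : count (∁ others) ≡ 1
      count-x = trans (∑-cong pw) (∑-δ x (λ _ → 1))
        where
        pw : ∀ y → 𝟙 (not (not (x == y))) ≡ 𝟙 (x == y) * 1
        pw y with x == y
        ... | true  = refl
        ... | false = refl

      α+β : α + β + 1 ≡ n
      α+β = trans (cong₂ _+_ (sym (count-split others P)) (sym count-x)) (count-not others)

      only-x : ∀ y → ∁ others y ≡ true → x ≡ y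
      only-x y h = ==⇒≡ x y (not-false (not-true h))

      degree-sum : ∑ (deg G) ≤ e G A A + 2 * e G A B + e G B B + 2 * (a + b)
      degree-sum = begin
        ∑ (deg G)
          ≡⟨ e-split G everything others ⟩
        e G others others + 2 * e G others (∁ others) + e G (∁ others) (∁ others)
          ≤⟨ +-mono-≤ (+-mono-≤ (≤-reflexive (e-split G others P)) (2 ⊗ star)) loop ⟩
        e G A A + 2 * e G A B + e G B B + 2 * (a + b) + 0
          ≡⟨ +-identityʳ _ ⟩
        e G A A + 2 * e G A B + e G B B + 2 * (a + b) ∎
        where
        open ≤-Reasoning
        star : e G others (∁ others) ≤ a + b
        star = ≤-trans (≤-reflexive (e-sym G others (∁ others))) (≤-trans
          (e-≤ G (∁ others) others (a + b) λ y h → ≤-trans (count-mono (∩-⊆ʳ others (adj G y)))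
            (≤-reflexive (subst (λ z → count (adj G z) ≡ a + b) (only-x y h) (count-split (adj G x) P))))
          (≤-reflexive (trans (cong ((a + b) *_) count-x) (*-identityʳ (a + b)))))
        loop : e G (∁ others) (∁ others) ≤ 0
        loop = e-≤ G (∁ others) (∁ others) 0 λ y h → ≮⇒≥ λ 1≤ →
          case count-pick (∁ others ∩ adj G y) 1≤ of λ where
            (z , k , _) → let oz , yz = ∧-true {∁ others z} k in
              adj⇒≢ G yz (trans (sym (only-x y h)) (only-x z oz))

      -- Inner degrees at most 2 and α + β = n - 1 turn the density into (α - β)² + 4M + 21 ≤ 4(a +
      -- b), where 21 = 17 + 1 + 3. Since 21 exceeds 20, integrality gives six.
      degree-x : M + 6 ≤ a + b
      degree-x = arith n α β M (a + b) (∑ (deg G)) (e G A A) (e G A B) (e G B B)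
          dense degree-sum AA≤ BB≤ (e+ē G A B) α+β (2xy≤x²+y² α β)
        where
        arith : ∀ n α β M d D AA AB BB → 1 + (n * n + 2 * n + 17) ≤ 2 * D → D ≤ AA + 2 * AB + BB + 2 * d →
                AA ≤ 2 * α → BB ≤ 2 * β → AB + M ≡ α * β → α + β + 1 ≡ n → 2 * (α * β) ≤ α * α + β * β → M + 6 ≤ d
        arith _ α β M d D AA AB BB h₁ h₂ h₃ h₄ h₅ refl h₆ = ≤-trans (≤-reflexive (shift M)) (*-cancelˡ-< 4 (5 + M) d
          (lin 0 (h₁ ⊕ 2 ⊗ h₂ ⊕ 2 ⊗ h₃ ⊕ 2 ⊗ h₄ ⊕ 4 ⊗ ≤-reflexive h₅ ⊕ h₆)
            (solve (α ∷ β ∷ M ∷ d ∷ D ∷ AA ∷ AB ∷ BB ∷ []))))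
          where
          shift : ∀ M → M + 6 ≡ 1 + (5 + M)
          shift M = solve (M ∷ [])

    -- Of the ab pairs between `X` and `Y` at most 2(a + b) - 4 are edges and at most M ≤ a + b - 6
    -- are missing, so (a - 3)(b - 3) would be negative.
    large-sides-absurd : 3 ≤ a → 3 ≤ b → ⊥
    large-sides-absurd 3≤a 3≤b = arith a b M (e G X Y) (ē G X Y) 3≤a 3≤b degree-x (e+ē G X Y) (crossing-edges G fas P x)
        (∑∑-mono λ p q → pw p q)
      where
      pw : ∀ p q → 𝟙 (X p ∧ Y q ∧ not (adj G p q)) ≤ 𝟙 (A p ∧ B q ∧ not (adj G p q))
      pw p q with X p in Xp | Y q in Yq
      ... | false | _     = z≤n
      ... | true  | false = z≤n
      ... | true  | true rewrite X⊆A p Xp | Y⊆B q Yq = ≤-refl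
      arith : ∀ a b M E Ē → 3 ≤ a → 3 ≤ b → M + 6 ≤ a + b → E + Ē ≡ a * b → E + 4 ≤ 2 * (a + b) → Ē ≤ M → ⊥
      arith a b M E Ē 3≤a 3≤b h₁ h₂ h₃ h₄ with m≤n⇒∃[o]m+o≡n 3≤a | m≤n⇒∃[o]m+o≡n 3≤b
      ... | s , refl | t , refl = absurd (s * t) (h₁ ⊕ ≤-reflexive (sym h₂) ⊕ h₃ ⊕ h₄) (solve (s ∷ t ∷ M ∷ E ∷ Ē ∷ []))

    module _ (a≤2 : a ≤ 2) (2≤r : 2 ≤ count (B ∩ ∁ (adj G x))) where

      private
        R : Sub n
        R = B ∩ ∁ (adj G x)

        4≤b : 4 ≤ b
        4≤b = arith a b M a≤2 degree-x
          where
          arith : ∀ a b M → a ≤ 2 → M + 6 ≤ a + b → 4 ≤ b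
          arith a b M h k = lin M (h ⊕ k) (solve (a ∷ b ∷ M ∷ []))

        susp : Suspension G fas P x
        susp = suspension G fas P x a≤2 4≤b λ y Yy → ≤-trans
          (count-mono λ z h → let Yz , yz = ∧-true {Y z} h in ∧-intro (Y⊆B z Yz) yz) (B-deg y (Y⊆B y Yy))

        open Suspension susp
        open Pair poles

        b+r : b + count R ≡ β
        b+r = trans (cong (_+ count R) (count-cong λ z → iff⇒≡ {Y z} {(B ∩ adj G x) z}
            (λ h → ∧-intro (Y⊆B z h) (∩-⊆ˡ (adj G x) (∁ P) z h))
            (λ h → let Bz , xz = ∧-true {B z} h in ∧-intro xz (∩-⊆ʳ others (∁ P) z Bz))))
          (sym (count-split B (adj G x)))

        -- No edge joins `Y` to `R`: the two neighbours of `y` in `Y` exhaust its degree in `B`.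
        closed : ∀ y z → Y y ≡ true → B z ≡ true → adj G y z ≡ true → adj G x z ≡ true
        closed y z Yy Bz yz = count-full (B ∩ adj G y) (adj G x)
          (≤-trans (B-deg y (Y⊆B y Yy)) (≤-trans (≤-reflexive (sym (two-regular y Yy)))
            (count-mono λ u h → let Yu , yu = ∧-true {Y u} h in
              ∧-intro (∧-intro (Y⊆B u Yu) yu) (∩-⊆ˡ (adj G x) (∁ P) u Yu))))
          z (∧-intro Bz yz)

        missing-row : Fin n → ℕ
        missing-row p = count (B ∩ ∁ (adj G p))

        M-rows : ∑ (λ p → 𝟙 (A p) * missing-row p) ≡ M
        M-rows = sym (ē-rows G A B)

        three-rows : ∀ {s t z} → A s ≡ true → A t ≡ true → A z ≡ true → s ≢ t → s ≢ z → t ≢ z →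
                     missing-row s + (missing-row t + (missing-row z + 0)) ≤ M
        three-rows {s} {t} {z} As At Az st sz tz = ≤-trans (≤-reflexive (cong₂ _+_ (row s As) (cong₂ _+_ (row t At)
            (cong (_+ 0) (row z Az)))))
          (≤-trans (∑-3 (λ p → 𝟙 (A p) * missing-row p) st sz tz) (≤-reflexive M-rows))
          where
          row : ∀ p → A p ≡ true → missing-row p ≡ 𝟙 (A p) * missing-row p
          row p Ap = trans (sym (+-identityʳ _)) (cong (λ c → 𝟙 c * missing-row p) (sym Ap))

        two-rows : ∀ {s t} → A s ≡ true → A t ≡ true → s ≢ t → missing-row s + missing-row t ≤ M
        two-rows {s} {t} As At st = begin
          missing-row s + missing-row t
            ≡⟨ cong₂ _+_ (row s As) (trans (row t At) (at t)) ⟩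
          g s + 𝟙 (not (s == t)) * g t
            ≤⟨ +-monoʳ-≤ (g s) (∑-≥ (λ p → 𝟙 (not (s == p)) * g p) t) ⟩
          g s + ∑ (λ p → 𝟙 (not (s == p)) * g p)
            ≡⟨ trans (sym (∑-split s g)) M-rows ⟩
          M ∎
          where
          open ≤-Reasoning
          g : Fin n → ℕ
          g p = 𝟙 (A p) * missing-row p
          row : ∀ p → A p ≡ true → missing-row p ≡ g p
          row p Ap = trans (sym (+-identityʳ _)) (cong (λ c → 𝟙 c * missing-row p) (sym Ap))
          at : ∀ t′ → g t ≡ 𝟙 (not (s == t)) * g t
          at _ = trans (sym (+-identityʳ (g t))) (cong (λ c → 𝟙 (not c) * g t) (sym (≢⇒== st)))

        M<b+4 : M + 4 ≤ b
        M<b+4 = arith a b M a≤2 degree-x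
          where
          arith : ∀ a b M → a ≤ 2 → M + 6 ≤ a + b → M + 4 ≤ b
          arith a b M h k = lin 0 (h ⊕ k) (solve (a ∷ b ∷ M ∷ []))

        -- Apart from the two vertices completing the triangle, each vertex of `B` is missed by a
        -- corner. So β ≤ M + 2, whereas β = b + |R| ≥ M + 6.
        no-inner-triangle : ∀ s t z → A s ≡ true → A t ≡ true → A z ≡ true →
                            adj G s t ≡ true → adj G t z ≡ true → adj G s z ≡ true → ⊥
        no-inner-triangle s t z As At Az st tz sz = arith β (count R) b M (missing-row s) (missing-row t) (missing-row z)
            cover b+r 2≤r (three-rows As At Az (adj⇒≢ G st) (adj⇒≢ G sz) (adj⇒≢ G tz)) M<b+4
          where
          L : Sub n
          L q = adj G s q ∧ adj G t q ∧ adj G z q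
          cover : β ≤ missing-row s + (missing-row t + (missing-row z + 2))
          cover = begin
            β
              ≤⟨ ∑-mono (λ q → bool≤ 4 (λ Bq sq tq zq → 𝟙 Bq , 𝟙 (Bq ∧ not sq) + (𝟙 (Bq ∧ not tq) +
                   (𝟙 (Bq ∧ not zq) + 𝟙 (sq ∧ tq ∧ zq)))) refl (B q) (adj G s q) (adj G t q) (adj G z q)) ⟩
            ∑ (λ q → 𝟙 (ms q) + (𝟙 (mt q) + (𝟙 (mz q) + 𝟙 (L q))))
              ≡⟨ trans (∑-+ (𝟙 ∘ ms) (λ q → 𝟙 (mt q) + (𝟙 (mz q) + 𝟙 (L q)))) (cong (count ms +_)
                   (trans (∑-+ (𝟙 ∘ mt) (λ q → 𝟙 (mz q) + 𝟙 (L q))) (cong (count mt +_)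
                     (trans (∑-+ (𝟙 ∘ mz) (𝟙 ∘ L)) (cong (count mz +_) (link-triangle G fas s t z st tz sz)))))) ⟩
            missing-row s + (missing-row t + (missing-row z + 2)) ∎
            where
            open ≤-Reasoning
            ms mt mz : Sub n
            ms = B ∩ ∁ (adj G s)
            mt = B ∩ ∁ (adj G t)
            mz = B ∩ ∁ (adj G z)
          arith : ∀ β r b M f g h → β ≤ f + (g + (h + 2)) → b + r ≡ β → 2 ≤ r → f + (g + (h + 0)) ≤ M → M + 4 ≤ b → ⊥
          arith _ r b M f g h k₁ refl k₂ k₃ k₄ =
            absurd 3 (k₁ ⊕ k₂ ⊕ k₃ ⊕ k₄) (solve (r ∷ b ∷ M ∷ f ∷ g ∷ h ∷ []))

        -- The link of s t is a cycle inside B, so it lies entirely in Y or entirely in R; it cannot miss Y.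
        link-misses-R : ∀ s t q → A s ≡ true → A t ≡ true → adj G s t ≡ true → R q ≡ true →
                        adj G s q ≡ true → adj G t q ≡ true → ⊥
        link-misses-R s t q As At st Rq sq tq =
            arith b M (missing-row s) (missing-row t) cover (two-rows As At (adj⇒≢ G st)) M<b+4
          where
          E : Sub n
          E = lkE G s t
          P-of : ∀ v → A v ≡ true → P v ≡ true
          P-of = ∩-⊆ʳ others P
          -- Otherwise `s` and `t` would both be poles of the link of `x`, yet adjacent.
          x∉E : E x ≡ true → ⊥
          x∉E h = let sx , tx = ∧-true {adj G s x} h
                      Xs = ∧-intro (trans (adj-sym G x s) sx) (P-of s As)
                      Xt = ∧-intro (trans (adj-sym G x t) tx) (P-of t At)
            in case only s Xs , only t Xt of λ where
              (inj₁ refl , inj₁ refl) → adj⇒≢ G st refl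
              (inj₁ refl , inj₂ refl) → true≢false st nonadjacent
              (inj₂ refl , inj₁ refl) → true≢false st (trans (adj-sym G p₂ p₁) nonadjacent)
              (inj₂ refl , inj₂ refl) → adj⇒≢ G st refl
          E⊆B : ∀ z → E z ≡ true → B z ≡ true
          E⊆B z Ez = by-cases (x == z) (P z) refl refl
            where
            by-cases : ∀ c d → (x == z) ≡ c → P z ≡ d → B z ≡ true
            by-cases true  _     x=z _  = ⊥-elim (x∉E (subst (λ u → E u ≡ true) (sym (==⇒≡ x z x=z)) Ez))
            by-cases false false x≠z Pz = ∧-intro (cong not x≠z) (cong not Pz)
            by-cases false true  x≠z Pz = let sz , tz = ∧-true {adj G s z} Ez in
              ⊥-elim (no-inner-triangle s t z As At (∧-intro (cong not x≠z) Pz) st tz sz)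
          avoids : ∀ z → E z ≡ true → adj G x z ≡ false
          avoids = let _ , _ , cyc = fb s t st in
            cycle-connected G cyc (λ z → adj G x z ≡ false)
              (λ y z Ey Ez yz xy → not-true (back y z Ey Ez yz xy (adj G x z) refl))
              q (∧-intro sq tq) (not-true (∩-⊆ʳ B (∁ (adj G x)) q Rq))
            where
            back : ∀ y z → E y ≡ true → E z ≡ true → adj G y z ≡ true → adj G x y ≡ false →
                   ∀ c → adj G x z ≡ c → not (adj G x z) ≡ true
            back y z Ey Ez yz xy false xz = cong not xz
            back y z Ey Ez yz xy true  xz = true≢false
              (closed z y (∧-intro xz (∩-⊆ʳ others (∁ P) z (E⊆B z Ez))) (E⊆B y Ey) (trans (adj-sym G z y) yz)) xy
          -- A link of `s t` that avoids `Y` leaves every vertex of `Y` missed by `s` or `t`, but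
          -- there are fewer than `b` missing pairs.
          cover : b ≤ missing-row s + missing-row t
          cover = ≤-trans (∑-mono λ z → pw z (adj G s z) (adj G t z) refl refl)
            (≤-reflexive (∑-+ (𝟙 ∘ (B ∩ ∁ (adj G s))) (𝟙 ∘ (B ∩ ∁ (adj G t)))))
            where
            pw : ∀ z c d → adj G s z ≡ c → adj G t z ≡ d → 𝟙 (Y z) ≤ 𝟙 (B z ∧ not (adj G s z)) + 𝟙 (B z ∧ not (adj G t z))
            pw z c d sz tz with Y z in Yz
            ... | false = z≤n
            pw z true  true  sz tz | true =
              true≢false (∩-⊆ˡ (adj G x) (∁ P) z Yz) (avoids z (∧-intro sz tz))
            pw z false d     sz tz | true rewrite sz | Y⊆B z Yz = s≤s z≤n
            pw z true  false sz tz | true rewrite sz | tz | Y⊆B z Yz = s≤s z≤n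
          arith : ∀ b M f g → b ≤ f + g → f + g ≤ M → M + 4 ≤ b → ⊥
          arith b M f g h k l = absurd 3 (h ⊕ k ⊕ l) (solve (b ∷ M ∷ f ∷ g ∷ []))

        -- For an inner edge, each vertex of `R` is missed by one of its ends. A missing pair is
        -- charged through at most two inner edges at its end in `A`, each in two orders.
        few-inner : e G A A * count R ≤ 4 * M
        few-inner = begin
          e G A A * count R
            ≡⟨ sym (trans (∑-cong λ s → ∑-*ʳ (count R) (λ t → 𝟙 (A s ∧ A t ∧ adj G s t)))
                          (∑-*ʳ (count R) (λ s → ∑ λ t → 𝟙 (A s ∧ A t ∧ adj G s t)))) ⟩
          ∑ (λ s → ∑ λ t → 𝟙 (A s ∧ A t ∧ adj G s t) * count R)
            ≤⟨ ∑∑-mono (λ s t → edge s t) ⟩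
          ∑ (λ s → ∑ λ t → w s t * missing-row s + w s t * missing-row t)
            ≡⟨ ∑∑-+ (λ s t → w s t * missing-row s) (λ s t → w s t * missing-row t) ⟩
          tails + ∑ (λ s → ∑ λ t → w s t * missing-row t)
            ≡⟨ cong (tails +_) (trans (∑-swap (λ s t → w s t * missing-row t))
                 (∑∑-cong λ t s → cong (_* missing-row t) (w-sym s t))) ⟩
          tails + tails
            ≤⟨ +-mono-≤ tails≤ tails≤ ⟩
          2 * M + 2 * M
            ≡⟨ four M ⟩
          4 * M ∎
          where
          open ≤-Reasoning
          four : ∀ M → 2 * M + 2 * M ≡ 4 * M
          four M = solve (M ∷ [])
          w : Fin n → Fin n → ℕ
          w s t = 𝟙 (A s ∧ A t ∧ adj G s t)
          tails : ℕ
          tails = ∑ λ s → ∑ λ t → w s t * missing-row s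
          w-sym : ∀ s t → w s t ≡ w t s
          w-sym s t = trans (cong (λ c → 𝟙 (A s ∧ A t ∧ c)) (adj-sym G s t)) (𝟙-swap (A s) (A t) (adj G t s))
          tails≤ : tails ≤ 2 * M
          tails≤ = ≤-trans (∑-mono λ s → ≤-trans (≤-reflexive (trans (∑-*ʳ (missing-row s) (w s))
                (cong (_* missing-row s) (trans (∑-cong λ t → 𝟙-∧ (A s) (A t ∧ adj G s t)) (∑-* (𝟙 (A s)) (𝟙 ∘ (A ∩ adj G s)))))))
              (pw s (A s) refl))
            (≤-reflexive (trans (∑-* 2 (λ s → 𝟙 (A s) * missing-row s)) (cong (2 *_) M-rows)))
            where
            pw : ∀ s c → A s ≡ c → 𝟙 c * count (A ∩ adj G s) * missing-row s ≤ 2 * (𝟙 c * missing-row s)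
            pw s false _  = z≤n
            pw s true  As = ≤-trans (*-monoˡ-≤ (missing-row s) (≤-trans (≤-reflexive (+-identityʳ _)) (A-deg s As)))
              (≤-reflexive (cong (2 *_) (sym (+-identityʳ (missing-row s)))))
          edge : ∀ s t → w s t * count R ≤ w s t * missing-row s + w s t * missing-row t
          edge s t = by-case (A s ∧ A t ∧ adj G s t) refl
            where
            by-case : ∀ c → (A s ∧ A t ∧ adj G s t) ≡ c → 𝟙 c * count R ≤ 𝟙 c * missing-row s + 𝟙 c * missing-row t
            by-case false _ = z≤n
            by-case true  h = ≤-trans (≤-reflexive (+-identityʳ (count R)))
              (≤-trans (∑-mono λ q → pw q (adj G s q) (adj G t q) refl refl)
                (≤-reflexive (trans (∑-+ (𝟙 ∘ (B ∩ ∁ (adj G s))) (𝟙 ∘ (B ∩ ∁ (adj G t))))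
                  (cong₂ _+_ (sym (+-identityʳ (missing-row s))) (sym (+-identityʳ (missing-row t)))))))
              where
              As : A s ≡ true
              As = proj₁ (∧-true {A s} h)
              At : A t ≡ true
              At = proj₁ (∧-true {A t} (proj₂ (∧-true {A s} h)))
              st : adj G s t ≡ true
              st = proj₂ (∧-true {A t} (proj₂ (∧-true {A s} h)))
              pw : ∀ q c d → adj G s q ≡ c → adj G t q ≡ d → 𝟙 (R q) ≤ 𝟙 (B q ∧ not (adj G s q)) + 𝟙 (B q ∧ not (adj G t q))
              pw q c d sq tq with R q in Rq
              ... | false = z≤n
              pw q true  true  sq tq | true = ⊥-elim (link-misses-R s t q As At st Rq sq tq)
              pw q false d     sq tq | true rewrite sq | ∩-⊆ˡ B (∁ (adj G x)) q Rq = s≤s z≤n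
              pw q true  false sq tq | true rewrite sq | tq | ∩-⊆ˡ B (∁ (adj G x)) q Rq = s≤s z≤n

      -- As |R| ≥ 2, `few-inner` gives e(A, A) ≤ 2M, which is exactly cancelled by the `M` edges
      -- lost between `A` and `B`. With a ≤ 2 and b ≤ β - 2 the density then leaves (α - β + 2)² +
      -- 17 ≤ 0.
      small-side-absurd : ⊥
      small-side-absurd = arith n α β a b (count R) M (∑ (deg G)) (e G A A) (e G A B) (e G B B)
          dense degree-sum (≤-trans (*-monoʳ-≤ (e G A A) 2≤r) few-inner) BB≤ (e+ē G A B) α+β a≤2 b+r 2≤r
          (2xy≤x²+y² (α + 2) β)
        where
        arith : ∀ n α β a b r M D AA AB BB → 1 + (n * n + 2 * n + 17) ≤ 2 * D → D ≤ AA + 2 * AB + BB + 2 * (a + b) →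
                AA * 2 ≤ 4 * M → BB ≤ 2 * β → AB + M ≡ α * β → α + β + 1 ≡ n → a ≤ 2 → b + r ≡ β → 2 ≤ r →
                2 * ((α + 2) * β) ≤ (α + 2) * (α + 2) + β * β → ⊥
        arith _ α _ a b r M D AA AB BB h₁ h₂ h₃ h₄ h₅ refl h₆ refl h₇ h₈ = absurd 16
          (h₁ ⊕ 2 ⊗ h₂ ⊕ h₃ ⊕ 2 ⊗ h₄ ⊕ 4 ⊗ ≤-reflexive h₅ ⊕ 4 ⊗ h₆ ⊕ 4 ⊗ h₇ ⊕ h₈)
          (solve (α ∷ a ∷ b ∷ r ∷ M ∷ D ∷ AA ∷ AB ∷ BB ∷ []))

-- Excluding an exceptional vertex

module _ {n : ℕ} (G : Graph n) (fas : Fascinating G) (dense : n * n + 2 * n + 17 < 2 * ∑ (deg G))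
         (S : Sub n) (x : Fin n) (1000<n : 1000 < n)
         (opposite-large : ∀ v → 40 * n ≤ 2 * (40 * opposite G S v) + n)
         (inner-small : 20 * (6 * inner G S x) ≤ n) (miss-large : n ≤ 10 * miss G S x)
         (inner≤2 : ∀ v → x ≢ v → count ((adj G v ∩ side G S v) ∖ x) ≤ 2) where

  private
    P : Sub n
    P = side G S x

    others : Sub n
    others y = not (x == y)

    beyond≥2 : 2 ≤ count ((others ∩ ∁ P) ∩ ∁ (adj G x))
    beyond≥2 = ≤-trans (arith (miss G S x) miss-large (≤-trans (m≤m+n 20 981) 1000<n)) (count-mono λ y h →
      let xy , o = ∧-true {not (adj G x y)} h in ∧-intro (∧-intro (distinct y (x ≟ y) o) o) xy)
      where
      arith : ∀ m → n ≤ 10 * m → 20 ≤ n → 2 ≤ m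
      arith m h k = *-cancelˡ-≤ 10 (≤-trans k h)
      agree-refl : ∀ a → agree a a ≡ true
      agree-refl true  = refl
      agree-refl false = refl
      distinct : ∀ y → Dec (x ≡ y) → not (P y) ≡ true → others y ≡ true
      distinct y (no x≢y)   _ = cong not (≢⇒== x≢y)
      distinct y (yes refl) o = true≢false (agree-refl (S x)) (not-true o)

    -- The side of `x` is the side opposite any vertex that `x` misses across the cut, so it has at
    -- least 39n/80 vertices, of which at most n/120 are neighbours of `x`.
    own-side≥2 : 2 ≤ count ((others ∩ P) ∩ ∁ (adj G x))
    own-side≥2 = case count-pick (∁ (adj G x) ∩ ∁ P) (≤-trans (s≤s z≤n) miss≥1) of λ where
        (y , h , _) → arith (count P) (inner G S x) (count ((others ∩ P) ∩ ∁ (adj G x))) cover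
          (subst (λ c → 40 * n ≤ 2 * (40 * c) + n)
            (count-cong λ z → opposite² (S x) (S y) (S z) (∩-⊆ʳ (∁ (adj G x)) (∁ P) y h)) (opposite-large y))
          inner-small (≤-trans (m≤m+n 12 989) 1000<n)
      where
      miss≥1 : 1 ≤ miss G S x
      miss≥1 = *-cancelˡ-≤ 10 (≤-trans (≤-trans (m≤m+n 10 991) 1000<n) miss-large)
      opposite² : ∀ a b c → not (agree a b) ≡ true → not (agree b c) ≡ agree a c
      opposite² true  false true  _ = refl
      opposite² true  false false _ = refl
      opposite² false true  true  _ = refl
      opposite² false true  false _ = refl
      cover : count P ≤ 1 + (inner G S x + count ((others ∩ P) ∩ ∁ (adj G x)))
      cover = ≤-trans (∑-mono λ y → bool≤ 3 (λ xy a o → 𝟙 o ,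
            𝟙 xy * 1 + (𝟙 (a ∧ o) + 𝟙 ((not xy ∧ o) ∧ not a))) refl (x == y) (adj G x y) (P y))
        (≤-reflexive (trans (∑-+ (λ y → 𝟙 (x == y) * 1) (λ y → 𝟙 (adj G x y ∧ P y) + 𝟙 ((others y ∧ P y) ∧ not (adj G x y))))
          (cong₂ _+_ (∑-δ x (λ _ → 1)) (∑-+ (λ y → 𝟙 (adj G x y ∧ P y)) (λ y → 𝟙 ((others y ∧ P y) ∧ not (adj G x y)))))))
      arith : ∀ o i r → o ≤ 1 + (i + r) → 40 * n ≤ 2 * (40 * o) + n → 20 * (6 * i) ≤ n → 12 ≤ n → 2 ≤ r
      arith o i r h₁ h₂ h₃ h₄ = *-cancelˡ-≤ 80 (lin (216 + 40 * i)
        (80 ⊗ h₁ ⊕ h₂ ⊕ h₃ ⊕ 38 ⊗ h₄) (solve (n ∷ o ∷ i ∷ r ∷ [])))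

    inner≤2-P : ∀ v → x ≢ v → count ((adj G v ∩ side G P v) ∖ x) ≤ 2
    inner≤2-P v x≢v = ≤-trans (≤-reflexive (count-cong λ w → cong (λ c → (adj G v w ∧ c) ∧ not (x == w))
      (agree-agree (S x) (S v) (S w)))) (inner≤2 v x≢v)
      where
      agree-agree : ∀ a b c → agree (agree a b) (agree a c) ≡ agree b c
      agree-agree true  _     _     = refl
      agree-agree false true  true  = refl
      agree-agree false true  false = refl
      agree-agree false false true  = refl
      agree-agree false false false = refl

    inner≤2-∁P : ∀ v → x ≢ v → count ((adj G v ∩ side G (∁ P) v) ∖ x) ≤ 2
    inner≤2-∁P v x≢v = ≤-trans (≤-reflexive (count-cong λ w → cong (λ c → (adj G v w ∧ c) ∧ not (x == w))
      (agree-not (P v) (P w)))) (inner≤2-P v x≢v)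
      where
      agree-not : ∀ a b → agree (not a) (not b) ≡ agree a b
      agree-not true  true  = refl
      agree-not true  false = refl
      agree-not false _     = refl

  -- Since `x` belongs to neither of the sets left after its removal, the two sides are
  -- interchangeable and the argument for a small side serves `P` and `∁ P` alike.
  exceptional-absurd : ⊥
  exceptional-absurd with count (adj G x ∩ P) ≤? 2 | count (adj G x ∩ ∁ P) ≤? 2
  ... | yes a≤2 | _       = small-side-absurd G fas dense x P inner≤2-P a≤2 beyond≥2
  ... | no _    | yes b≤2 = small-side-absurd G fas dense x (∁ P) inner≤2-∁P b≤2
    (≤-trans own-side≥2 (≤-reflexive (count-cong λ y → cong (λ c → (others y ∧ c) ∧ not (adj G x y)) (sym (not-involutive (P y))))))
  ... | no a≰2  | no b≰2  = large-sides-absurd G fas dense x P inner≤2-P (≰⇒> a≰2) (≰⇒> b≰2)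

-- Choice of constants and conclusion

module _ {n : ℕ} (G : Graph n) (fas : Fascinating G) (dense : n * n + 2 * n + 17 < 2 * ∑ (deg G))
         (K : ℕ) (6800≤K : 170 * 40 ≤ K) (large : 36 * (K * K) ≤ n) where

  private
    large-for : ∀ k → k ≤ K → 36 * (k * k) ≤ n
    large-for k k≤K = ≤-trans (36 ⊗ *-mono-≤ k≤K k≤K) large

    1000<n : 1000 < n
    1000<n = ≤-trans (m≤m+n 1001 295) (large-for 6 (≤-trans (m≤m+n 6 6794) 6800≤K))

  partition-join : ∀ S → ∑ (inner G S) ≤ 18 * n → (∀ v → inner G S v ≤ cross G S v) → IsJoinOfTwoCycles G
  partition-join S few max = by-cases (any? λ v → n ≤? 10 * miss G S v)
    where
    opposite-large′ : ∀ v → 40 * n ≤ 2 * (40 * opposite G S v) + n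
    opposite-large′ = opposite-large G fas dense 40 (large-for 40 (≤-trans (m≤m+n 40 6760) 6800≤K)) S few max
    inner-small′ : ∀ v → 20 * (6 * inner G S v) ≤ n
    inner-small′ v = ≤-trans (≤-reflexive (sym (*-assoc 20 6 (inner G S v))))
      (inner-small G fas dense 120 (large-for 120 (≤-trans (m≤m+n 120 6680) 6800≤K)) S few max v)
    inner-tiny′ : ∀ v → K * inner G S v ≤ n
    inner-tiny′ = inner-small G fas dense K large S few max
    missing≤′ : ∑ (miss G S) ≤ 17 * n
    missing≤′ = missing≤ G fas dense K large S few max
    missing≤inner′ : ∑ (miss G S) + n ≤ ∑ (inner G S)
    missing≤inner′ = missing≤inner G fas dense K large S few max
    by-cases : Dec (∃[ v ] n ≤ 10 * miss G S v) → IsJoinOfTwoCycles G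
    by-cases (yes (x , missed)) = ⊥-elim (exceptional-absurd G fas dense S x 1000<n opposite-large′ (inner-small′ x) missed
      (inner≤2-off G fas S K 6800≤K 1000<n opposite-large′ inner-small′ inner-tiny′ missing≤′ missing≤inner′
        x missed))
    by-cases (no none) = join G fas S 1000<n opposite-large′
      (all-typical⇒inner≤2 G fas S K 6800≤K 1000<n opposite-large′ inner-small′ inner-tiny′ missing≤′ missing≤inner′ miss-small)
      miss-small
      where
      miss-small : ∀ v → 10 * miss G S v < n
      miss-small v = ≰⇒> λ h → none (v , h)

  dense-join : IsJoinOfTwoCycles G
  dense-join = let S , few , max = sparse-partition G fas dense in partition-join S few max

theorem1p6 : ∃[ n₀ ] (∀ (n : ℕ) (G : Graph n) → Fascinating G → n₀ ≤ n →
    n ^ 2 + 2 * n + 17 < 4 * edges G → IsJoinOfTwoCycles G)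
theorem1p6 = 36 * (6800 * 6800) , λ n G fas large dense → dense-join G fas
  (subst₂ (λ a b → a + 2 * n + 17 < b) (cong (n *_) (*-identityʳ n))
    (trans (*-assoc 2 2 (edges G)) (cong (2 *_) (sym (handshake G everything)))) dense)
  6800 ≤-refl large
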